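{- Let $G=(V,E)$ be an undirected graph with $n=|V|$ vertices and $m=|E|$ edges, and let $\bar\delta$ be its average degeneracy. Counting the 4-cycles incident to each vertex of $G$ (that is, computing $\square(v)$ for all $v\in V$) takes $O(m\bar\delta)$ time and $O(n)$ space; i.e. there is an algorithm which, given any such $G$, computes all the values $\square(v)$, $v\in V$, within these bounds.
   Context: Graphs are finite, simple and undirected, with vertices labeled by $[n]=\{1,\dots,n\}$; $N(v)=\{u: uv\in E\}$ and $d(v)=|N(v)|$. The average degeneracy is $\bar\delta=\frac1m\sum_{uv\in E}\min\{d(u),d(v)\}$. A 4-cycle ($C_4$) is a sequence of four distinct vertices $x,y,z,w$ with $xy,yz,zw,wx\in E$; the eight sequences obtained from it by cyclic shifts and reversal count as a single distinct 4-cycle. $\square(v)$ denotes the number of distinct 4-cycles of $G$ containing the vertex $v$. Computational model: the input graph is given in adjacency-list form, with an arbitrary ordering of the neighbors of each vertex; vertex degrees can be looked up in constant time; array access, comparison and addition on words take constant time. Time bounds are worst-case bounds for deterministic algorithms (no hashing or randomness). Space is measured in words and does not include the storage of the input graph.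
   Formalization: The time bound O(mδ̄) is proved for nonempty graphs without isolated vertices; for arbitrary graphs the bound proved is O(1+n+mδ̄), since O(mδ̄) fails for, e.g., one 4-cycle plus many isolated vertices. Space O(n) and correctness hold for all graphs. -}

module Defs where

open import Data.Fin.Base using (Fin; toℕ)
open import Data.Fin.Properties using (_≟_; _<?_)
open import Data.Integer.Base using (+_)
open import Data.List.Base as List using (List; []; _∷_; allFin; cartesianProduct; cartesianProductWith; deduplicate; filter; length; map)
import Data.List.Membership.DecPropositional as ListMembership
open import Data.List.Membership.Propositional using () renaming (_∈_ to _∈ₗ_)
open import Data.List.Relation.Unary.Unique.Propositional using () renaming (Unique to Uniqueₗ)
open import Data.Nat.Base as ℕ using (ℕ; zero; suc; _+_; _⊓_)
open import Data.Nat.ListAction using (sum)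
open import Data.Product.Base using (_×_; _,_; ∃-syntax)
open import Data.Rational.Base using (ℚ; 0ℚ; _/_)
open import Data.Vec.Base as Vec using (Vec; []; _∷_; lookup; replicate; _[_]≔_)
import Data.Vec.Membership.DecPropositional as VecMembership
open import Data.Vec.Membership.Propositional using (_∈_)
open import Data.Vec.Properties using (≡-dec)
open import Data.Vec.Relation.Unary.AllPairs using (allPairs?)
open import Data.Vec.Relation.Unary.Unique.Propositional using (Unique)
open import Function.Bundles using (_⇔_)
open import Level using (0ℓ)
open import Relation.Binary.Core using (Rel)
open import Relation.Binary.Definitions using (Decidable; DecidableEquality; Symmetric)
open import Relation.Binary.PropositionalEquality using (_≡_)
import Relation.Unary as U
open import Relation.Nullary using (¬_; ¬?; _×-dec_)

------------------------------------------------------------------------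
-- Graphs

-- Vertices are labelled 0, …, n-1 rather than 1, …, n.
record Graph (n : ℕ) : Set₁ where
  infix 4 _~_ _~?_
  field
    _~_      : Rel (Fin n) 0ℓ
    _~?_     : Decidable _~_
    ~-sym    : Symmetric _~_
    ~-irrefl : ∀ v → ¬ (v ~ v)

  N : Fin n → List (Fin n)
  N v = filter (v ~?_) (allFin n)

  d : Fin n → ℕ
  d v = length (N v)

  -- Each undirected edge is listed once, as the pair (u , v) with u < v.
  edges : List (Fin n × Fin n)
  edges = filter (λ (u , v) → (u <? v) ×-dec (u ~? v))
                 (cartesianProduct (allFin n) (allFin n))

  m : ℕ
  m = length edges

toℚ : ℕ → ℚ
toℚ k = + k / 1

-- The mean of the empty list is 0 by convention.
mean : List ℕ → ℚ
mean []          = 0ℚ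
mean xs@(_ ∷ _) = + sum xs / length xs

avgDegeneracy : ∀ {n} → Graph n → ℚ
avgDegeneracy G = mean (map (λ (u , v) → d u ⊓ d v) edges)
  where open Graph G

------------------------------------------------------------------------
-- 4-cycles

module _ {A : Set} where

  shift : Vec A 4 → Vec A 4
  shift (x ∷ y ∷ z ∷ w ∷ []) = y ∷ z ∷ w ∷ x ∷ []

  orbit : Vec A 4 → List (Vec A 4)
  orbit s = List.iterate shift s 4 List.++ List.iterate shift (Vec.reverse s) 4

  SameCycle : Rel (Vec A 4) 0ℓ
  SameCycle s t = t ∈ₗ orbit s

  sameCycle? : DecidableEquality A → Decidable SameCycle
  sameCycle? _≟ᴬ_ s t = t ∈? orbit s
    where open ListMembership (≡-dec _≟ᴬ_) using (_∈?_)

allVecs : ∀ n k → List (Vec (Fin n) k)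
allVecs n zero    = [] ∷ []
allVecs n (suc k) = cartesianProductWith _∷_ (allFin n) (allVecs n k)

module _ {n} (G : Graph n) where
  open Graph G

  ClosedWalk₄ : Vec (Fin n) 4 → Set
  ClosedWalk₄ (x ∷ y ∷ z ∷ w ∷ []) = x ~ y × y ~ z × z ~ w × w ~ x

  closedWalk₄? : U.Decidable ClosedWalk₄
  closedWalk₄? (x ∷ y ∷ z ∷ w ∷ []) =
    (x ~? y) ×-dec (y ~? z) ×-dec (z ~? w) ×-dec (w ~? x)

  IsC₄ : Vec (Fin n) 4 → Set
  IsC₄ s = Unique s × ClosedWalk₄ s

  isC₄? : U.Decidable IsC₄
  isC₄? s = allPairs? (λ x y → ¬? (x ≟ y)) s ×-dec closedWalk₄? s

  -- One representative of each SameCycle-class is kept.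
  □ : Fin n → ℕ
  □ v = length (deduplicate (sameCycle? _≟_)
          (filter (λ s → isC₄? s ×-dec (v ∈? s)) (allVecs n 4)))
    where open VecMembership _≟_ using (_∈?_)

-- The neighbours of each vertex, in an arbitrary order.
record AdjacencyLists {n} (G : Graph n) : Set where
  open Graph G
  field
    nbrs     : Fin n → List (Fin n)
    unique   : ∀ v → Uniqueₗ (nbrs v)
    complete : ∀ {v u} → u ∈ₗ nbrs v ⇔ v ~ u

------------------------------------------------------------------------
-- A deterministic word RAM with k registers, s memory cells and read-only
-- access to the input graph. The only arithmetic is addition.

infix  6 _⊕_
infix  5 _≔_
infixr 4 _⨾_

data Expr (k : ℕ) : Set where
  lit  : ℕ → Expr k
  size : Expr k                     -- the number n of vertices
  reg  : Fin k → Expr k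
  _⊕_  : Fin k → Fin k → Expr k
  deg  : Fin k → Expr k
  nbr  : Fin k → Fin k → Expr k     -- nbr r q: entry q of the list of r
  load : Fin k → Expr k

data Program (k : ℕ) : Set where
  skip      : Program k
  _≔_       : Fin k → Expr k → Program k
  store     : Fin k → Fin k → Program k    -- store r q: cell r gets q
  _⨾_       : Program k → Program k → Program k
  if_<_then_else_  : Fin k → Fin k → Program k → Program k → Program k
  while_<_loop_     : Fin k → Fin k → Program k → Program k

record State (k s : ℕ) : Set where
  constructor ⟨_,_⟩
  field
    regs : Vec ℕ k
    mem  : Vec ℕ s

open State public

initial : ∀ {k s} → State k s
initial = ⟨ replicate _ 0 , replicate _ 0 ⟩

Holds : ∀ {s} → Vec ℕ s → ℕ → ℕ → Set
Holds M a x = ∃[ i ] (toℕ i ≡ a × lookup M i ≡ x)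

module _ {n} {G : Graph n} (A : AdjacencyLists G) where
  open AdjacencyLists A

  data Value {k s} (σ : State k s) : Expr k → ℕ → Set where
    lit  : ∀ x → Value σ (lit x) x
    size : Value σ size n
    reg  : ∀ r → Value σ (reg r) (lookup (regs σ) r)
    _⊕_  : ∀ r q → Value σ (r ⊕ q) (lookup (regs σ) r + lookup (regs σ) q)
    deg  : ∀ {r} v → toℕ v ≡ lookup (regs σ) r →
           Value σ (deg r) (length (nbrs v))
    nbr  : ∀ {r q} v (i : Fin (length (nbrs v))) →
           toℕ v ≡ lookup (regs σ) r → toℕ i ≡ lookup (regs σ) q →
           Value σ (nbr r q) (toℕ (List.lookup (nbrs v) i))
    load : ∀ {r x} → Holds (mem σ) (lookup (regs σ) r) x →
           Value σ (load r) x

  -- Run W P σ t τ: started in σ, P halts in τ after exactly t steps, and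
  -- every word computed on the way is below W. Overflowing words and
  -- out-of-range accesses have no rule: such an execution is stuck.
  data Run {k s} (W : ℕ) : Program k → State k s → ℕ → State k s → Set where
    skip  : ∀ {σ} → Run W skip σ 1 σ
    _≔_   : ∀ {σ e x} r → Value σ e x → x ℕ.< W →
            Run W (r ≔ e) σ 1 ⟨ regs σ [ r ]≔ x , mem σ ⟩
    store : ∀ {σ r} q i → toℕ i ≡ lookup (regs σ) r →
            Run W (store r q) σ 1 ⟨ regs σ , mem σ [ i ]≔ lookup (regs σ) q ⟩
    _⨾_   : ∀ {σ τ υ P Q t₁ t₂} → Run W P σ t₁ τ → Run W Q τ t₂ υ →
            Run W (P ⨾ Q) σ (t₁ + t₂) υ
    if-yes : ∀ {σ τ r q P Q t} → lookup (regs σ) r ℕ.< lookup (regs σ) q →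
             Run W P σ t τ → Run W (if r < q then P else Q) σ (suc t) τ
    if-no  : ∀ {σ τ r q P Q t} → ¬ (lookup (regs σ) r ℕ.< lookup (regs σ) q) →
             Run W Q σ t τ → Run W (if r < q then P else Q) σ (suc t) τ
    while-stop : ∀ {σ r q P} → ¬ (lookup (regs σ) r ℕ.< lookup (regs σ) q) →
                 Run W (while r < q loop P) σ 1 σ
    while-step : ∀ {σ τ υ r q P t₁ t₂} →
                 lookup (regs σ) r ℕ.< lookup (regs σ) q →
                 Run W P σ t₁ τ → Run W (while r < q loop P) τ t₂ υ →
                 Run W (while r < q loop P) σ (suc (t₁ + t₂)) υ

{-# OPTIONS --safe #-}

-- Order the vertices by degree, ties broken by label. Every 4-cycle has a unique
-- largest vertex v (its top), and is then a pair of wedges v - u - y with the same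
-- y, where u and y precede v. For each v the program walks twice over its wedges.
-- The first walk keeps the number of wedges ending in y so far; a new wedge closes
-- that many cycles, which are credited to v and y. If L wedges end in y, each
-- middle vertex u lies on L - 1 cycles with top v and opposite vertex y; as the
-- machine cannot subtract, the first walk also stores the count before its last
-- increment, and the second walk adds this number to u and clears the counter of y.
-- Only vertices u with d(u) ≤ d(v) are expanded, so the edge uv costs
-- O(min{d(u),d(v)}).

module Submission where

open import Defs
open import Data.Bool.Base using () renaming (if_then_else_ to when_then_else_)
open import Data.Fin using (#_)
open import Data.Fin.Base using (Fin; zero; suc; toℕ; combine)
open import Data.Fin.Patterns using (0F; 1F; 2F)
open import Data.Fin.Properties
  using (_≟_; _<?_; toℕ<n; toℕ-injective; toℕ-combine; combine-injectiveˡ; combine-injectiveʳ)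
open import Data.Integer.Base as ℤ using () renaming (+_ to fromℕ)
import Data.Integer.Properties as ℤ
open import Data.List.Base as List
  using (List; []; _∷_; _++_; _ʳ++_; allFin; deduplicate; filter; length; map; reverse)
open import Data.List.Membership.Propositional using () renaming (_∈_ to _∈ₗ_)
open import Data.List.Membership.Propositional.Properties
  using ( ∈-++⁺ˡ; ∈-++⁺ʳ; ∈-++⁻; ∈-∃++; ∈-map⁺; ∈-map⁻; ∈-filter⁺; ∈-filter⁻; ∈-allFin; ∈-lookup; ∈-length
        ; ∈-cartesianProduct⁺; ∈-cartesianProductWith⁺)
open import Data.List.Properties
  using ( filter-accept; filter-reject; length-++; length-filter; length-map; length-reverse
        ; length-tabulate; map-++; map-cong; reverse-involutive)
import Data.List.Relation.Binary.Permutation.Setoid as Permutation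
import Data.List.Relation.Binary.Permutation.Setoid.Properties as PermProperties
open import Data.List.Relation.Binary.Subset.Propositional using (_⊆_)
open import Data.List.Relation.Unary.All as All using (All; []; _∷_)
import Data.List.Relation.Unary.All.Properties as All
open import Data.List.Relation.Unary.AllPairs as AllPairs using (AllPairs; []; _∷_)
import Data.List.Relation.Unary.AllPairs.Properties as AllPairs
open import Data.List.Relation.Unary.Any using (here; there)
open import Data.List.Relation.Unary.Any.Properties using (deduplicate⁻; reverse⁺; reverse⁻)
open import Data.List.Relation.Unary.Unique.Propositional using () renaming (Unique to Uniqueₗ)
import Data.List.Relation.Unary.Unique.Propositional.Properties as Unique
open import Data.Nat.Base as ℕ using (ℕ; zero; suc; pred; NonZero; _+_; _*_; _^_; _⊓_; _≤_; _<_; z≤n; s≤s)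
open import Data.Nat.ListAction using (sum)
open import Data.Nat.ListAction.Properties using (sum-++)
import Data.Nat.Properties as ℕ
open import Data.Nat.Tactic.RingSolver using (solve-∀)
open import Algebra.Properties.CommutativeSemigroup ℕ.+-commutativeSemigroup using (interchange; x∙yz≈y∙xz)
open import Data.Product.Base using (Σ-syntax; ∃-syntax; _×_; _,_; proj₁; proj₂; swap)
open import Data.Product.Properties using (,-injectiveʳ)
open import Data.Rational.Base as ℚ using (ℚ; toℚᵘ)
import Data.Rational.Properties as ℚ
open import Data.Rational.Unnormalised.Base as ℚᵘ using (mkℚᵘ; *≡*; *≤*)
import Data.Rational.Unnormalised.Properties as ℚᵘ
open import Data.Sum.Base using (_⊎_; inj₁; inj₂)
open import Data.Vec.Base as Vec using (Vec; []; _∷_; lookup; _[_]≔_)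
import Data.Vec.Membership.DecPropositional as VecMembership
open import Data.Vec.Membership.Propositional using (_∈_; _∉_)
open import Data.Vec.Properties using (lookup∘update; lookup∘update′; lookup-replicate)
open import Data.Vec.Relation.Unary.All using ([]; _∷_)
open import Data.Vec.Relation.Unary.AllPairs using ([]; _∷_)
open import Data.Vec.Relation.Unary.Any using (here; there)
open import Data.Vec.Relation.Unary.Unique.Propositional using (Unique)
open import Function.Base using (_∘_; const)
open import Function.Bundles using (Equivalence)
open import Level using (0ℓ)
open import Relation.Binary.Core using (Rel)
import Relation.Binary.Definitions as B
open import Relation.Binary.Definitions using (tri<; tri≈; tri>)
open import Relation.Binary.PropositionalEquality
open import Relation.Nullary using (¬_; ¬?; does; yes; no; contradiction; _×-dec_; _⊎-dec_)
open import Relation.Nullary.Decidable using (dec-true; dec-false)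

-- Correctness is an accounting identity. `quads` lists the pairs of wedges with a common end that
-- meet at a top `v`, and `credit` shows that, for each vertex `x`, what both walks add to the cell
-- of `x` is the number of occurrences of `x` in that list. Concatenated over all tops, the lists
-- form a transversal of the classes of `SameCycle`. So does the deduplicated list defining `□`, and
-- two transversals have the same number of members through `x`. An overflowing word leaves the
-- machine stuck, so a run exists only if every intermediate value is bounded beforehand. This is
-- why exact memory contents are carried along with crude polynomial bounds. Besides the walks there
-- is a constant cost per edge and per vertex. An edge pays its own, as both its ends have degree at
-- least 1; an isolated vertex has nothing to be charged to, and on a graph without edges the
-- product of `m` and the average degeneracy is 0 although every run takes a step. Hence the general
-- time bound has the extra term `1 + n`, which disappears when there is a vertex and none is
-- isolated.

-- Sums and cardinalities over lists.

module _ {A : Set} where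

  sumBy : (A → ℕ) → List A → ℕ
  sumBy f xs = sum (map f xs)

  sumBy-++ : ∀ f xs ys → sumBy f (xs ++ ys) ≡ sumBy f xs + sumBy f ys
  sumBy-++ f xs ys = trans (cong sum (map-++ f xs ys)) (sum-++ (map f xs) (map f ys))

  sumBy-const : ∀ c xs → sumBy (const c) xs ≡ length xs * c
  sumBy-const c []       = refl
  sumBy-const c (x ∷ xs) = cong (c +_) (sumBy-const c xs)

  sumBy-+ : ∀ f g xs → sumBy (λ x → f x + g x) xs ≡ sumBy f xs + sumBy g xs
  sumBy-+ f g []       = refl
  sumBy-+ f g (x ∷ xs) rewrite sumBy-+ f g xs = interchange (f x) (g x) (sumBy f xs) (sumBy g xs)

  sumBy-mono : ∀ f g xs → (∀ {x} → x ∈ₗ xs → f x ≤ g x) → sumBy f xs ≤ sumBy g xs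
  sumBy-mono f g []       h = z≤n
  sumBy-mono f g (x ∷ xs) h = ℕ.+-mono-≤ (h (here refl)) (sumBy-mono f g xs (h ∘ there))

  sumBy-≤ : ∀ f c xs → (∀ {x} → x ∈ₗ xs → f x ≤ c) → sumBy f xs ≤ length xs * c
  sumBy-≤ f c xs h = ℕ.≤-trans (sumBy-mono f (const c) xs h) (ℕ.≤-reflexive (sumBy-const c xs))

sumBy-* : ∀ {A : Set} c (f : A → ℕ) xs → sumBy (λ x → c * f x) xs ≡ c * sumBy f xs
sumBy-* c f []       = sym (ℕ.*-zeroʳ c)
sumBy-* c f (x ∷ xs) rewrite sumBy-* c f xs = sym (ℕ.*-distribˡ-+ c (f x) (sumBy f xs))

sumBy-map : ∀ {A B : Set} (g : B → ℕ) (f : A → B) xs → sumBy g (map f xs) ≡ sumBy (g ∘ f) xs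
sumBy-map g f []       = refl
sumBy-map g f (x ∷ xs) = cong (g (f x) +_) (sumBy-map g f xs)

-- Greedy matching: the witness of the head is removed from `ys`. Since no `y` is related to two
-- entries of `xs`, it is not the witness of a later entry, so the rest is still covered.
sum-cover : ∀ {A B : Set} {R : A → B → Set} (f : A → ℕ) (g : B → ℕ) xs ys →
            AllPairs (λ x x′ → ∀ y → R x y → ¬ R x′ y) xs →
            (∀ {x} → x ∈ₗ xs → ∃[ y ] (y ∈ₗ ys × R x y × f x ≤ g y)) →
            sumBy f xs ≤ sumBy g ys
sum-cover f g []       ys _          _   = z≤n
sum-cover {R = R} f g (x ∷ xs) ys (px ∷ pxs) cov
  with y , y∈ , Rxy , fx≤gy ← cov (here refl)
  with as , bs , refl ← ∈-∃++ y∈ = begin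
    f x + sumBy f xs          ≤⟨ ℕ.+-mono-≤ fx≤gy (sum-cover f g xs (as ++ bs) pxs cov′) ⟩
    g y + sumBy g (as ++ bs)  ≡⟨ cong (g y +_) (sumBy-++ g as bs) ⟩
    g y + (sumBy g as + sumBy g bs) ≡⟨ x∙yz≈y∙xz (g y) (sumBy g as) (sumBy g bs) ⟩
    sumBy g as + (g y + sumBy g bs) ≡⟨ sumBy-++ g as (y ∷ bs) ⟨
    sumBy g (as ++ y ∷ bs)    ∎
  where
  open ℕ.≤-Reasoning
  cov′ : ∀ {x′} → x′ ∈ₗ xs → ∃[ z ] (z ∈ₗ as ++ bs × R x′ z × f x′ ≤ g z)
  cov′ x′∈ with z , z∈ , Rx′z , le ← cov (there x′∈) with ∈-++⁻ as z∈
  ... | inj₁ p            = z , ∈-++⁺ˡ p , Rx′z , le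
  ... | inj₂ (there p)    = z , ∈-++⁺ʳ as p , Rx′z , le
  ... | inj₂ (here refl)  = contradiction Rx′z (All.lookup px x′∈ z Rxy)

length-allFin : ∀ n → length (List.allFin n) ≡ n
length-allFin n = length-tabulate {n = n} (λ i → i)

length-cover : ∀ {A B : Set} {R : A → B → Set} xs ys →
               AllPairs (λ x x′ → ∀ y → R x y → ¬ R x′ y) xs →
               (∀ {x} → x ∈ₗ xs → ∃[ y ] (y ∈ₗ ys × R x y)) →
               length xs ≤ length ys
length-cover xs ys sep cov = subst₂ _≤_ (card xs) (card ys)
  (sum-cover (const 1) (const 1) xs ys sep
    (λ x∈ → let y , y∈ , Rxy = cov x∈ in y , y∈ , Rxy , s≤s z≤n))
  where
  card : ∀ {C : Set} (zs : List C) → sumBy (const 1) zs ≡ length zs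
  card zs = trans (sumBy-const 1 zs) (ℕ.*-identityʳ _)

module _ {A : Set} {xs ys : List A} where

  private
    separated : Uniqueₗ xs → AllPairs (λ x x′ → ∀ y → x ≡ y → x′ ≢ y) xs
    separated = AllPairs.map λ { x≢x′ y refl refl → x≢x′ refl }

  sumBy-⊆ : ∀ f → Uniqueₗ xs → xs ⊆ ys → sumBy f xs ≤ sumBy f ys
  sumBy-⊆ f uniq xs⊆ys =
    sum-cover f f xs ys (separated uniq) (λ x∈ → _ , xs⊆ys x∈ , refl , ℕ.≤-refl)

  length-⊆ : Uniqueₗ xs → xs ⊆ ys → length xs ≤ length ys
  length-⊆ uniq xs⊆ys = length-cover xs ys (separated uniq) (λ x∈ → _ , xs⊆ys x∈ , refl)

module _ {A B : Set} (F : A → List B) where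

  pairsOf : List A → List (A × B)
  pairsOf []       = []
  pairsOf (x ∷ xs) = map (x ,_) (F x) ++ pairsOf xs

  ∈-pairsOf⁺ : ∀ {xs x y} → x ∈ₗ xs → y ∈ₗ F x → (x , y) ∈ₗ pairsOf xs
  ∈-pairsOf⁺ (here refl) y∈ = ∈-++⁺ˡ (∈-map⁺ _ y∈)
  ∈-pairsOf⁺ (there x∈)  y∈ = ∈-++⁺ʳ _ (∈-pairsOf⁺ x∈ y∈)

  ∈-pairsOf⁻ : ∀ xs {x y} → (x , y) ∈ₗ pairsOf xs → x ∈ₗ xs × y ∈ₗ F x
  ∈-pairsOf⁻ (x ∷ xs) p with ∈-++⁻ (map (x ,_) (F x)) p
  ... | inj₂ q with x∈ , y∈ ← ∈-pairsOf⁻ xs q = there x∈ , y∈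
  ... | inj₁ q with _ , y∈ , refl ← ∈-map⁻ (x ,_) q = here refl , y∈

  pairsOf-unique : ∀ {xs} → Uniqueₗ xs → (∀ x → Uniqueₗ (F x)) → Uniqueₗ (pairsOf xs)
  pairsOf-unique {[]}     []         uF = []
  pairsOf-unique {x ∷ xs} u@(_ ∷ us) uF =
    Unique.++⁺ (Unique.map⁺ ,-injectiveʳ (uF x)) (pairsOf-unique us uF) disjoint
    where
    disjoint : ∀ {p} → ¬ (p ∈ₗ map (x ,_) (F x) × p ∈ₗ pairsOf xs)
    disjoint (p∈ , q∈) with _ , _ , refl ← ∈-map⁻ (x ,_) p∈ =
      Unique.Unique[x∷xs]⇒x∉xs u (proj₁ (∈-pairsOf⁻ xs q∈))

  sumBy-pairsOf : ∀ (g : A × B → ℕ) xs →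
                  sumBy g (pairsOf xs) ≡ sumBy (λ x → sumBy (λ y → g (x , y)) (F x)) xs
  sumBy-pairsOf g []       = refl
  sumBy-pairsOf g (x ∷ xs) = trans (sumBy-++ g (map (x ,_) (F x)) (pairsOf xs))
    (cong₂ _+_ (sumBy-map g (x ,_) (F x)) (sumBy-pairsOf g xs))

  length-pairsOf : ∀ {b} xs → (∀ x → length (F x) ≤ b) → length (pairsOf xs) ≤ length xs * b
  length-pairsOf []       h = z≤n
  length-pairsOf (x ∷ xs) h = ℕ.≤-trans (ℕ.≤-reflexive (length-++ (map (x ,_) (F x))))
    (ℕ.+-mono-≤ (ℕ.≤-trans (ℕ.≤-reflexive (length-map (x ,_) (F x))) (h x)) (length-pairsOf xs h))

module _ {A : Set} where

  -- For a loop that has processed `xs`, newest first, and still faces `ys`: with `j = 0`, the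
  -- number of processed elements is the position of the next one in the whole list.
  lookup-ʳ++ : ∀ (xs ys : List A) (j : Fin (length ys)) →
               ∃[ i ] (toℕ i ≡ length xs + toℕ j × List.lookup (xs ʳ++ ys) i ≡ List.lookup ys j)
  lookup-ʳ++ []       ys j = j , refl , refl
  lookup-ʳ++ (x ∷ xs) ys j with i , i≡ , eq ← lookup-ʳ++ xs (x ∷ ys) (suc j) =
    i , trans i≡ (ℕ.+-suc (length xs) (toℕ j)) , eq

-- The dihedral symmetry of 4-cycles.

module _ {A : Set} where

  orbit-shift : ∀ s {t : Vec A 4} → SameCycle s t → SameCycle s (shift t)
  orbit-shift (x ∷ y ∷ z ∷ w ∷ []) = λ where
    (here refl)                         → there (here refl)
    (there (here refl))                 → there (there (here refl))
    (there (there (here refl)))         → there (there (there (here refl)))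
    (there (there (there (here refl)))) → here refl
    (there (there (there (there (here refl)))))                         →
      there (there (there (there (there (here refl)))))
    (there (there (there (there (there (here refl))))))                 →
      there (there (there (there (there (there (here refl))))))
    (there (there (there (there (there (there (here refl)))))))         →
      there (there (there (there (there (there (there (here refl)))))))
    (there (there (there (there (there (there (there (here refl)))))))) →
      there (there (there (there (here refl))))

  orbit-reverse : ∀ s {t : Vec A 4} → SameCycle s t → SameCycle s (Vec.reverse t)
  orbit-reverse (x ∷ y ∷ z ∷ w ∷ []) = λ where
    (here refl)                         → there (there (there (there (here refl))))
    (there (here refl))                 → there (there (there (there (there (there (there (here refl)))))))
    (there (there (here refl)))         → there (there (there (there (there (there (here refl))))))
    (there (there (there (here refl)))) → there (there (there (there (there (here refl)))))
    (there (there (there (there (here refl)))))                         → here refl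
    (there (there (there (there (there (here refl))))))                 →
      there (there (there (here refl)))
    (there (there (there (there (there (there (here refl)))))))         →
      there (there (here refl))
    (there (there (there (there (there (there (there (here refl)))))))) →
      there (here refl)

  sameCycle-refl : ∀ {s : Vec A 4} → SameCycle s s
  sameCycle-refl = here refl

  -- Every member of `orbit t` arises from `t` by shifts and reversal, and `orbit s` is closed under
  -- both.
  sameCycle-trans : ∀ {s t u : Vec A 4} → SameCycle s t → SameCycle t u → SameCycle s u
  sameCycle-trans {s} {t} s∼t = All.lookup orbit⊆
    where
    turn : ∀ {r} → SameCycle s r → SameCycle s (shift r)
    turn = orbit-shift s
    r∼ : SameCycle s (Vec.reverse t)
    r∼ = orbit-reverse s s∼t
    orbit⊆ : All (SameCycle s) (orbit t)
    orbit⊆ = s∼t ∷ turn s∼t ∷ turn (turn s∼t) ∷ turn (turn (turn s∼t)) ∷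
             r∼ ∷ turn r∼ ∷ turn (turn r∼) ∷ turn (turn (turn r∼)) ∷ []

  sameCycle-sym : ∀ {s t : Vec A 4} → SameCycle s t → SameCycle t s
  sameCycle-sym {x ∷ y ∷ z ∷ w ∷ []} = λ where
    (here refl)                         → here refl
    (there (here refl))                 → there (there (there (here refl)))
    (there (there (here refl)))         → there (there (here refl))
    (there (there (there (here refl)))) → there (here refl)
    (there (there (there (there (here refl)))))                         →
      there (there (there (there (here refl))))
    (there (there (there (there (there (here refl))))))                 →
      there (there (there (there (there (here refl)))))
    (there (there (there (there (there (there (here refl)))))))         →
      there (there (there (there (there (there (here refl))))))
    (there (there (there (there (there (there (there (here refl)))))))) →
      there (there (there (there (there (there (there (here refl)))))))

  sameCycle-∈ : ∀ {s t : Vec A 4} {x} → SameCycle s t → x ∈ s → x ∈ t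
  sameCycle-∈ {s} {x = x} s∼t x∈s = All.lookup all∈ s∼t
    where
    turn : ∀ {r : Vec A 4} → x ∈ r → x ∈ shift r
    turn {_ ∷ _ ∷ _ ∷ _ ∷ []} (here p)                         = there (there (there (here p)))
    turn {_ ∷ _ ∷ _ ∷ _ ∷ []} (there (here p))                 = here p
    turn {_ ∷ _ ∷ _ ∷ _ ∷ []} (there (there (here p)))         = there (here p)
    turn {_ ∷ _ ∷ _ ∷ _ ∷ []} (there (there (there (here p)))) = there (there (here p))
    flip : ∀ {r : Vec A 4} → x ∈ r → x ∈ Vec.reverse r
    flip {_ ∷ _ ∷ _ ∷ _ ∷ []} (here p)                         = there (there (there (here p)))
    flip {_ ∷ _ ∷ _ ∷ _ ∷ []} (there (here p))                 = there (there (here p))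
    flip {_ ∷ _ ∷ _ ∷ _ ∷ []} (there (there (here p)))         = there (here p)
    flip {_ ∷ _ ∷ _ ∷ _ ∷ []} (there (there (there (here p)))) = here p
    r∋ : x ∈ Vec.reverse s
    r∋ = flip x∈s
    all∈ : All (x ∈_) (orbit s)
    all∈ = x∈s ∷ turn x∈s ∷ turn (turn x∈s) ∷ turn (turn (turn x∈s)) ∷
           r∋ ∷ turn r∋ ∷ turn (turn r∋) ∷ turn (turn (turn r∋)) ∷ []

-- Deduplication yields a transversal.

module _ {A : Set} {R : Rel A 0ℓ} (R? : B.Decidable R) where

  deduplicate-separated : ∀ xs → AllPairs (λ x y → ¬ R x y) (deduplicate R? xs)
  deduplicate-separated []       = []
  deduplicate-separated (x ∷ xs) =
    All.all-filter (¬? ∘ R? x) (deduplicate R? xs) ∷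
    AllPairs.filter⁺ (¬? ∘ R? x) (deduplicate-separated xs)

  -- The representative found for `x` in the tail may itself be discarded in favour of the head; by
  -- transitivity the head then represents `x`.
  deduplicate-covers : B.Reflexive R → B.Transitive R →
                       ∀ xs {x} → x ∈ₗ xs → ∃[ y ] (y ∈ₗ deduplicate R? xs × R y x)
  deduplicate-covers rfl tra (z ∷ xs) (here refl) = z , here refl , rfl
  deduplicate-covers rfl tra (z ∷ xs) {x} (there x∈) with y , y∈ , Ryx ← deduplicate-covers rfl tra xs x∈ with R? z y
  ... | no ¬Rzy = y , there (∈-filter⁺ (¬? ∘ R? z) y∈ ¬Rzy) , Ryx
  ... | yes Rzy = z , here refl , tra Rzy Ryx

-- Wedges, the 4-cycles they close, and the credits of the two walks.

δ : ∀ {n} → Fin n → Fin n → ℕ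
δ x y = when does (x ≟ y) then 1 else 0

δ-refl : ∀ {n} (x : Fin n) → δ x x ≡ 1
δ-refl x rewrite dec-true (x ≟ x) refl = refl

δ-≢ : ∀ {n} {x y : Fin n} → x ≢ y → δ x y ≡ 0
δ-≢ {x = x} {y} x≢y rewrite dec-false (x ≟ y) x≢y = refl

δ≤1 : ∀ {n} (x y : Fin n) → δ x y ≤ 1
δ≤1 x y with x ≟ y
... | yes _ = s≤s z≤n
... | no  _ = z≤n

module _ {n : ℕ} where

  quad : (v a y b : Fin n) → Vec (Fin n) 4
  quad v a y b = v ∷ a ∷ y ∷ b ∷ []

  -- A multiplicity and not a membership test, so that it splits into the shares of the two walks:
  -- the top and its opposite vertex on the left, the two middle vertices on the right.
  mult : Fin n → Vec (Fin n) 4 → ℕ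
  mult x (v ∷ a ∷ y ∷ b ∷ []) = (δ x v + δ x y) + (δ x a + δ x b)

  mult-∈ : ∀ {x q} → Unique q → x ∈ q → mult x q ≡ 1
  mult-∈ {x} ((v≢a ∷ v≢y ∷ v≢b ∷ []) ∷ _) (here refl)
    rewrite δ-refl x | δ-≢ v≢a | δ-≢ v≢y | δ-≢ v≢b = refl
  mult-∈ {x} ((v≢a ∷ _) ∷ (a≢y ∷ a≢b ∷ []) ∷ _) (there (here refl))
    rewrite δ-refl x | δ-≢ (v≢a ∘ sym) | δ-≢ a≢y | δ-≢ a≢b = refl
  mult-∈ {x} ((_ ∷ v≢y ∷ _) ∷ (a≢y ∷ _) ∷ (y≢b ∷ []) ∷ _) (there (there (here refl)))
    rewrite δ-refl x | δ-≢ (v≢y ∘ sym) | δ-≢ (a≢y ∘ sym) | δ-≢ y≢b = refl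
  mult-∈ {x} ((_ ∷ _ ∷ v≢b ∷ []) ∷ (_ ∷ a≢b ∷ []) ∷ (y≢b ∷ []) ∷ _) (there (there (there (here refl))))
    rewrite δ-refl x | δ-≢ (v≢b ∘ sym) | δ-≢ (a≢b ∘ sym) | δ-≢ (y≢b ∘ sym) = refl

  mult-∉ : ∀ {x q} → x ∉ q → mult x q ≡ 0
  mult-∉ {x} {v ∷ a ∷ y ∷ b ∷ []} x∉
    rewrite δ-≢ {x = x} {v} (λ p → x∉ (here p)) | δ-≢ {x = x} {a} (λ p → x∉ (there (here p)))
          | δ-≢ {x = x} {y} (λ p → x∉ (there (there (here p))))
          | δ-≢ {x = x} {b} (λ p → x∉ (there (there (there (here p))))) = refl

  open VecMembership (_≟_ {n}) using (_∈?_)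

  sumBy-mult : ∀ x {qs} → All Unique qs → sumBy (mult x) qs ≡ length (filter (x ∈?_) qs)
  sumBy-mult x []       = refl
  sumBy-mult x {q ∷ qs} (u ∷ us) with x ∈? q
  ... | yes x∈ = cong₂ _+_ (mult-∈ u x∈) (sumBy-mult x us)
  ... | no  x∉ = cong₂ _+_ (mult-∉ x∉) (sumBy-mult x us)

  Wedge : Set
  Wedge = Fin n × Fin n

  sel : Fin n → List Wedge → List (Fin n)
  sel y []             = []
  sel y ((u , z) ∷ ws) = when does (y ≟ z) then u ∷ sel y ws else sel y ws

  occ : Fin n → List Wedge → ℕ
  occ y = sumBy (λ (_ , z) → δ y z)

  length-sel : ∀ y ws → length (sel y ws) ≡ occ y ws
  length-sel y []             = refl
  length-sel y ((u , z) ∷ ws) with y ≟ z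
  ... | yes _ = cong suc (length-sel y ws)
  ... | no  _ = length-sel y ws

  occ≤length : ∀ y ws → occ y ws ≤ length ws
  occ≤length y ws = ℕ.≤-trans (sumBy-≤ _ 1 ws (λ {(_ , z)} _ → δ≤1 y z)) (ℕ.≤-reflexive (ℕ.*-identityʳ _))

  0<occ : ∀ {u y ws} → (u , y) ∈ₗ ws → 0 < occ y ws
  0<occ {y = y} (here refl) rewrite δ-refl y = s≤s z≤n
  0<occ (there p) = ℕ.≤-trans (0<occ p) (ℕ.m≤n+m _ _)

  ∈-sel⁺ : ∀ {u y ws} → (u , y) ∈ₗ ws → u ∈ₗ sel y ws
  ∈-sel⁺ {y = y} {ws = (_ , z) ∷ ws} p with y ≟ z | p
  ... | yes _   | here refl = here refl
  ... | yes _   | there q   = there (∈-sel⁺ q)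
  ... | no y≢z  | here refl = contradiction refl y≢z
  ... | no _    | there q   = ∈-sel⁺ q

  ∈-sel⁻ : ∀ {u y} ws → u ∈ₗ sel y ws → (u , y) ∈ₗ ws
  ∈-sel⁻ {y = y} ((_ , z) ∷ ws) p with y ≟ z | p
  ... | yes refl | here refl = here refl
  ... | yes _    | there q   = there (∈-sel⁻ ws q)
  ... | no _     | q         = there (∈-sel⁻ ws q)

  sel-unique : ∀ {y ws} → Uniqueₗ ws → Uniqueₗ (sel y ws)
  sel-unique []                                  = []
  sel-unique {y} {(u , z) ∷ ws} uniq@(_ ∷ us) with y ≟ z
  ... | yes refl = All.tabulate (λ { p refl → Unique.Unique[x∷xs]⇒x∉xs uniq (∈-sel⁻ ws p) }) ∷ sel-unique us
  ... | no  _    = sel-unique us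

  -- The newest wedge stands in front, so `b` is the middle of the wedge that closes the cycle and
  -- `a` that of an earlier one. Each pair of wedges with a common end is thus listed in one order
  -- only.
  quads : Fin n → List Wedge → List (Vec (Fin n) 4)
  quads v []             = []
  quads v ((b , y) ∷ ws) = map (λ a → quad v a y b) (sel y ws) ++ quads v ws

  ∈-quads⁻ : ∀ {v ws q} → Uniqueₗ ws → q ∈ₗ quads v ws →
             ∃[ a ] ∃[ y ] ∃[ b ] (q ≡ quad v a y b × (a , y) ∈ₗ ws × (b , y) ∈ₗ ws × a ≢ b)
  ∈-quads⁻ {v} {(b , y) ∷ ws} uniq@(_ ∷ us) q∈ with ∈-++⁻ (map _ (sel y ws)) q∈
  ... | inj₁ p with a , a∈ , refl ← ∈-map⁻ _ p =
    a , y , b , refl , there (∈-sel⁻ ws a∈) , here refl ,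
    λ { refl → Unique.Unique[x∷xs]⇒x∉xs uniq (∈-sel⁻ ws a∈) }
  ... | inj₂ p with a , z , c , eq , a∈ , c∈ , a≢c ← ∈-quads⁻ us p =
    a , z , c , eq , there a∈ , there c∈ , a≢c

  -- Which of the two orders occurs depends on which wedge was found first.
  ∈-quads⁺ : ∀ {v a y b ws} → (a , y) ∈ₗ ws → (b , y) ∈ₗ ws → a ≢ b →
             quad v a y b ∈ₗ quads v ws ⊎ quad v b y a ∈ₗ quads v ws
  ∈-quads⁺ (here refl) (here refl) a≢b = contradiction refl a≢b
  ∈-quads⁺ (here refl) (there b∈)  a≢b = inj₂ (∈-++⁺ˡ (∈-map⁺ _ (∈-sel⁺ b∈)))
  ∈-quads⁺ (there a∈)  (here refl) a≢b = inj₁ (∈-++⁺ˡ (∈-map⁺ _ (∈-sel⁺ a∈)))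
  ∈-quads⁺ (there a∈)  (there b∈)  a≢b with ∈-quads⁺ a∈ b∈ a≢b
  ... | inj₁ p = inj₁ (∈-++⁺ʳ _ p)
  ... | inj₂ p = inj₂ (∈-++⁺ʳ _ p)

  -- The first pass credits the top v and the opposite vertex y of each quad,
  -- the second one its two middle vertices.
  credit₁ : Fin n → Fin n → List Wedge → ℕ
  credit₁ x v []             = 0
  credit₁ x v ((u , y) ∷ ws) = credit₁ x v ws + (δ x y + δ x v) * occ y ws

  credit₂ : Fin n → List Wedge → List Wedge → ℕ
  credit₂ x all = sumBy (λ (u , y) → δ x u * pred (occ y all))

  credit₁-≤ : ∀ x v ws → credit₁ x v ws ≤ length ws * (2 * length ws)
  credit₁-≤ x v ws = go ws ℕ.≤-refl
    where
    open ℕ.≤-Reasoning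
    l = length ws
    go : ∀ as → length as ≤ l → credit₁ x v as ≤ length as * (2 * l)
    go []             _ = z≤n
    go ((u , y) ∷ as) h = begin
      credit₁ x v as + (δ x y + δ x v) * occ y as
        ≤⟨ ℕ.+-mono-≤ (go as (ℕ.<⇒≤ h))
             (ℕ.*-mono-≤ (ℕ.+-mono-≤ (δ≤1 x y) (δ≤1 x v)) (ℕ.≤-trans (occ≤length y as) (ℕ.<⇒≤ h))) ⟩
      length as * (2 * l) + 2 * l  ≡⟨ ℕ.+-comm _ (2 * l) ⟩
      2 * l + length as * (2 * l)  ∎

  credit₂-≤ : ∀ x all ws → credit₂ x all ws ≤ length ws * length all
  credit₂-≤ x all ws = sumBy-≤ _ (length all) ws λ {(u , y)} _ →
    ℕ.≤-trans (ℕ.*-mono-≤ (δ≤1 x u) (ℕ.≤-trans ℕ.pred[n]≤n (occ≤length y all))) (ℕ.≤-reflexive (ℕ.*-identityˡ _))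

  private
    δ-swap : ∀ (x y : Fin n) → δ x y ≡ δ y x
    δ-swap x y with x ≟ y
    ... | yes refl = sym (δ-refl x)
    ... | no x≢y   = sym (δ-≢ (x≢y ∘ sym))

    sumBy-sel : ∀ (f : Fin n → ℕ) y ws → sumBy f (sel y ws) ≡ sumBy (λ (u , z) → f u * δ z y) ws
    sumBy-sel f y []             = refl
    sumBy-sel f y ((u , z) ∷ ws) rewrite sym (δ-swap y z) with y ≟ z
    ... | yes _ = cong₂ _+_ (sym (ℕ.*-identityʳ (f u))) (sumBy-sel f y ws)
    ... | no  _ = cong₂ _+_ (sym (ℕ.*-zeroʳ (f u))) (sumBy-sel f y ws)

    -- Prepending a wedge ending in y raises pred (occ z) by δ z y for every z already reached.
    credit₂-∷ : ∀ x b y all ws → (∀ {w} → w ∈ₗ ws → w ∈ₗ all) →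
                credit₂ x ((b , y) ∷ all) ws ≡ sumBy (λ (u , z) → δ x u * δ z y) ws + credit₂ x all ws
    credit₂-∷ x b y all ws ws⊆ = trans (go ws ws⊆) (sumBy-+ _ _ ws)
      where
      pred-+ : ∀ d {k} → 0 < k → pred (d + k) ≡ d + pred k
      pred-+ d {suc k} _ = cong pred (ℕ.+-suc d k)
      go : ∀ as → (∀ {w} → w ∈ₗ as → w ∈ₗ all) → credit₂ x ((b , y) ∷ all) as ≡
             sumBy (λ (u , z) → δ x u * δ z y + δ x u * pred (occ z all)) as
      go []             _ = refl
      go ((u , z) ∷ as) h = cong₂ _+_
        (trans (cong (δ x u *_) (pred-+ (δ z y) (0<occ (h (here refl)))))
               (ℕ.*-distribˡ-+ (δ x u) (δ z y) _))
        (go as (h ∘ there))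

  -- Induction on the wedges. A new wedge with end `y` closes one cycle with each of the `k` older
  -- ones. The vertices `v`, `y` and the new middle `b` gain `k` each; every older middle vertex
  -- gains 1, seen by the second walk as a larger `pred (occ y _)`. The sum `S` collects these last
  -- gains.
  credit : ∀ x v ws → credit₁ x v ws + credit₂ x ws ws ≡ sumBy (mult x) (quads v ws)
  credit x v []             = refl
  credit x v ((b , y) ∷ ws) = begin
    (C₁ + (δ x y + δ x v) * k) + (δ x b * pred (δ y y + k) + credit₂ x ((b , y) ∷ ws) ws)
      ≡⟨ cong₂ (λ e₁ e₂ → (C₁ + (δ x y + δ x v) * k) + (δ x b * e₁ + e₂))
           (cong (λ e → pred (e + k)) (δ-refl y)) (credit₂-∷ x b y ws ws (λ w∈ → w∈)) ⟩
    (C₁ + (δ x y + δ x v) * k) + (δ x b * k + (S + C₂))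
      ≡⟨ rearrange (δ x y) (δ x v) (δ x b) k C₁ C₂ S ⟩
    (k * ((δ x v + δ x y) + δ x b) + S) + (C₁ + C₂)
      ≡⟨ cong₂ _+_ (sym fresh) (credit x v ws) ⟩
    sumBy (mult x) (map (λ a → quad v a y b) (sel y ws)) + sumBy (mult x) (quads v ws)
      ≡⟨ sumBy-++ (mult x) (map _ (sel y ws)) (quads v ws) ⟨
    sumBy (mult x) (quads v ((b , y) ∷ ws)) ∎
    where
    open ≡-Reasoning
    k = occ y ws
    C₁ = credit₁ x v ws
    C₂ = credit₂ x ws ws
    S = sumBy (λ (u , z) → δ x u * δ z y) ws
    rearrange : ∀ d e f k C₁ C₂ S → (C₁ + (d + e) * k) + (f * k + (S + C₂)) ≡ (k * ((e + d) + f) + S) + (C₁ + C₂)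
    rearrange = solve-∀
    exchange : ∀ p q r → p + (q + r) ≡ (p + r) + q
    exchange = solve-∀
    fresh : sumBy (mult x) (map (λ a → quad v a y b) (sel y ws)) ≡ k * ((δ x v + δ x y) + δ x b) + S
    fresh = begin
      sumBy (mult x) (map (λ a → quad v a y b) (sel y ws))
        ≡⟨ sumBy-map (mult x) (λ a → quad v a y b) (sel y ws) ⟩
      sumBy (λ a → (δ x v + δ x y) + (δ x a + δ x b)) (sel y ws)
        ≡⟨ cong sum (map-cong (λ a → exchange (δ x v + δ x y) (δ x a) (δ x b)) (sel y ws)) ⟩
      sumBy (λ a → ((δ x v + δ x y) + δ x b) + δ x a) (sel y ws)
        ≡⟨ sumBy-+ _ _ (sel y ws) ⟩
      sumBy (λ _ → (δ x v + δ x y) + δ x b) (sel y ws) + sumBy (δ x) (sel y ws)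
        ≡⟨ cong₂ _+_ (trans (sumBy-const _ (sel y ws)) (cong (_* _) (length-sel y ws)))
                     (sumBy-sel (δ x) y ws) ⟩
      k * ((δ x v + δ x y) + δ x b) + S ∎

-- The degree order and one representative of each 4-cycle.

module Order {n} {G : Graph n} (A : AdjacencyLists G) where
  open Graph G
  private
    module Perm = PermProperties (setoid (Fin n))
    module PermRel = Permutation (setoid (Fin n))
  open AdjacencyLists A

  deg′ : Fin n → ℕ
  deg′ v = length (nbrs v)

  infix 4 _≺_ _≺?_

  _≺_ : Rel (Fin n) 0ℓ
  u ≺ v = deg′ u < deg′ v ⊎ (deg′ u ≡ deg′ v × toℕ u < toℕ v)

  -- Opaque, so that goals mention `u ≺? v` itself and not the comparisons it is built from.
  abstract
    _≺?_ : B.Decidable _≺_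
    u ≺? v = (deg′ u ℕ.<? deg′ v) ⊎-dec ((deg′ u ℕ.≟ deg′ v) ×-dec (toℕ u ℕ.<? toℕ v))

  ≺-trans : B.Transitive _≺_
  ≺-trans (inj₁ p)       (inj₁ q)       = inj₁ (ℕ.<-trans p q)
  ≺-trans (inj₁ p)       (inj₂ (e , _)) = inj₁ (subst (_ <_) e p)
  ≺-trans (inj₂ (e , _)) (inj₁ q)       = inj₁ (subst (_< _) (sym e) q)
  ≺-trans (inj₂ (e , p)) (inj₂ (f , q)) = inj₂ (trans e f , ℕ.<-trans p q)

  ≺-irrefl : ∀ {v} → ¬ (v ≺ v)
  ≺-irrefl (inj₁ p)       = ℕ.<-irrefl refl p
  ≺-irrefl (inj₂ (_ , p)) = ℕ.<-irrefl refl p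

  ≺-asym : ∀ {u v} → u ≺ v → ¬ (v ≺ u)
  ≺-asym p q = ≺-irrefl (≺-trans p q)

  ≺⇒≢ : ∀ {u v} → u ≺ v → u ≢ v
  ≺⇒≢ p refl = ≺-irrefl p

  ≺-connex : ∀ {u v} → u ≢ v → u ≺ v ⊎ v ≺ u
  ≺-connex {u} {v} u≢v with ℕ.<-cmp (deg′ u) (deg′ v)
  ... | tri< p _ _ = inj₁ (inj₁ p)
  ... | tri> _ _ p = inj₂ (inj₁ p)
  ... | tri≈ _ e _ with ℕ.<-cmp (toℕ u) (toℕ v)
  ... | tri< p _ _ = inj₁ (inj₂ (e , p))
  ... | tri≈ _ p _ = contradiction (toℕ-injective p) u≢v
  ... | tri> _ _ p = inj₂ (inj₂ (sym e , p))

  ≺⇒deg≤ : ∀ {u v} → u ≺ v → deg′ u ≤ deg′ v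
  ≺⇒deg≤ (inj₁ p)       = ℕ.<⇒≤ p
  ≺⇒deg≤ (inj₂ (e , _)) = ℕ.≤-reflexive e

  fan : Fin n → Fin n → List (Fin n)
  fan v u = when does (u ≺? v) then filter (_≺? v) (reverse (nbrs u)) else []

  -- Reversed, because the loops collect what they have processed in front.
  wedges : Fin n → List Wedge
  wedges v = pairsOf (fan v) (reverse (nbrs v))

  record IsWedge (v u y : Fin n) : Set where
    constructor isWedge
    field
      u∈ : u ∈ₗ nbrs v
      y∈ : y ∈ₗ nbrs u
      u≺ : u ≺ v
      y≺ : y ≺ v

  open IsWedge

  ∈-wedges⁺ : ∀ {v u y} → IsWedge v u y → (u , y) ∈ₗ wedges v
  ∈-wedges⁺ {v} {u} {y} (isWedge u∈ y∈ u≺ y≺) = ∈-pairsOf⁺ (fan v) (reverse⁺ u∈) y∈fan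
    where
    y∈fan : y ∈ₗ fan v u
    y∈fan rewrite dec-true (u ≺? v) u≺ = ∈-filter⁺ (_≺? v) (reverse⁺ y∈) y≺

  ∈-wedges⁻ : ∀ {v u y} → (u , y) ∈ₗ wedges v → IsWedge v u y
  ∈-wedges⁻ {v} {u} p with u∈ , y∈ ← ∈-pairsOf⁻ (fan v) (reverse (nbrs v)) p with u ≺? v
  ... | yes u≺ with y∈′ , y≺ ← ∈-filter⁻ (_≺? v) {xs = reverse (nbrs u)} y∈ =
    isWedge (reverse⁻ u∈) (reverse⁻ y∈′) u≺ y≺

  reverse-unique : ∀ {xs : List (Fin n)} → Uniqueₗ xs → Uniqueₗ (reverse xs)
  reverse-unique {xs} = Perm.Unique-resp-↭ (PermRel.↭-sym (Perm.↭-reverse xs))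

  fan-unique : ∀ v u → Uniqueₗ (fan v u)
  fan-unique v u with u ≺? v
  ... | yes _ = Unique.filter⁺ (_≺? v) (reverse-unique (unique u))
  ... | no  _ = []

  wedges-unique : ∀ v → Uniqueₗ (wedges v)
  wedges-unique v = pairsOf-unique (fan v) (reverse-unique (unique v)) (fan-unique v)

  nbrs⇒~ : ∀ {v u} → u ∈ₗ nbrs v → v ~ u
  nbrs⇒~ = Equivalence.to complete

  ~⇒nbrs : ∀ {v u} → v ~ u → u ∈ₗ nbrs v
  ~⇒nbrs = Equivalence.from complete

  data Topped : Fin n → Vec (Fin n) 4 → Set where
    topped : ∀ {v a y b} → a ≢ b → IsWedge v a y → IsWedge v b y → Topped v (quad v a y b)

  quads-topped : ∀ {v q} → q ∈ₗ quads v (wedges v) → Topped v q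
  quads-topped {v} q∈ with _ , _ , _ , refl , a∈ , b∈ , a≢b ← ∈-quads⁻ (wedges-unique v) q∈ =
    topped a≢b (∈-wedges⁻ a∈) (∈-wedges⁻ b∈)

  topped-isC₄ : ∀ {v q} → Topped v q → IsC₄ G q
  topped-isC₄ (topped a≢b (isWedge a∈ y∈ a≺ y≺) (isWedge b∈ y∈′ b≺ _)) =
    ((≺⇒≢ a≺ ∘ sym) ∷ (≺⇒≢ y≺ ∘ sym) ∷ (≺⇒≢ b≺ ∘ sym) ∷ []) ∷
    ((λ { refl → ~-irrefl _ (nbrs⇒~ y∈) }) ∷ a≢b ∷ []) ∷
    ((λ { refl → ~-irrefl _ (nbrs⇒~ y∈′) }) ∷ []) ∷ [] ∷ [] ,
    nbrs⇒~ a∈ , nbrs⇒~ y∈ , ~-sym (nbrs⇒~ y∈′) , ~-sym (nbrs⇒~ b∈)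

  -- The top of a 4-cycle is its ≺-largest vertex, so it determines the opposite
  -- vertex, and the two middle vertices up to exchange.
  topped-sameCycle : ∀ {v a y b v′ a′ y′ b′} → a ≺ v → y ≺ v → b ≺ v → a′ ≺ v′ → y′ ≺ v′ → b′ ≺ v′ →
                     SameCycle (quad v a y b) (quad v′ a′ y′ b′) →
                     v ≡ v′ × y ≡ y′ × ((a ≡ a′ × b ≡ b′) ⊎ (a ≡ b′ × b ≡ a′))
  topped-sameCycle p q r p′ q′ r′ = λ where
    (here refl)                         → refl , refl , inj₁ (refl , refl)
    (there (here refl))                 → contradiction r′ (≺-asym p)
    (there (there (here refl)))         → contradiction q′ (≺-asym q)
    (there (there (there (here refl)))) → contradiction p′ (≺-asym r)
    (there (there (there (there (here refl)))))                         → contradiction r (≺-asym r′)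
    (there (there (there (there (there (here refl))))))                 → contradiction q (≺-asym q′)
    (there (there (there (there (there (there (here refl)))))))         → contradiction p (≺-asym p′)
    (there (there (there (there (there (there (there (here refl)))))))) →
      refl , refl , inj₂ (refl , refl)

  reps : List (Fin n) → List (Vec (Fin n) 4)
  reps []       = []
  reps (v ∷ vs) = quads v (wedges v) ++ reps vs

  ∈-reps⁺ : ∀ {v q vs} → v ∈ₗ vs → q ∈ₗ quads v (wedges v) → q ∈ₗ reps vs
  ∈-reps⁺ (here refl) q∈ = ∈-++⁺ˡ q∈
  ∈-reps⁺ (there v∈)  q∈ = ∈-++⁺ʳ _ (∈-reps⁺ v∈ q∈)

  ∈-reps⁻ : ∀ vs {q} → q ∈ₗ reps vs → ∃[ v ] (v ∈ₗ vs × Topped v q)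
  ∈-reps⁻ (v ∷ vs) q∈ with ∈-++⁻ (quads v (wedges v)) q∈
  ... | inj₁ p = v , here refl , quads-topped p
  ... | inj₂ p with w , w∈ , t ← ∈-reps⁻ vs p = w , there w∈ , t

  private
    Apart : Rel (Vec (Fin n) 4) 0ℓ
    Apart q r = ¬ SameCycle q r

  -- By `topped-sameCycle`, equal cycles share the opposite vertex and the set of middle vertices.
  -- Among the quads closed by `(b , y)` this forces the same `a`; an older quad would need `b` as a
  -- middle vertex of a wedge ending in `y`, but `(b , y)` occurs only once.
  quads-apart : ∀ {v ws} → Uniqueₗ ws → (∀ {u y} → (u , y) ∈ₗ ws → IsWedge v u y) → AllPairs Apart (quads v ws)
  quads-apart {ws = []} _ _ = []
  quads-apart {v} {(b , y) ∷ ws} uniq@(_ ∷ us) wedge =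
    AllPairs.++⁺ (AllPairs.map⁺ (within (sel y ws) (sel-unique us) (λ p → p))) (quads-apart us (wedge ∘ there)) across
    where
    new∉ : ¬ ((b , y) ∈ₗ ws)
    new∉ = Unique.Unique[x∷xs]⇒x∉xs uniq
    wb : IsWedge v b y
    wb = wedge (here refl)
    ws-wedge : ∀ {u z} → (u , z) ∈ₗ ws → IsWedge v u z
    ws-wedge = wedge ∘ there
    within : ∀ as → Uniqueₗ as → (∀ {a} → a ∈ₗ as → a ∈ₗ sel y ws) →
             AllPairs (λ a a′ → Apart (quad v a y b) (quad v a′ y b)) as
    within []       _        _ = []
    within (a ∷ as) (pa ∷ u) h = All.tabulate ap ∷ within as u (h ∘ there)
      where
      wa = ws-wedge (∈-sel⁻ ws (h (here refl)))
      ap : ∀ {a′} → a′ ∈ₗ as → Apart (quad v a y b) (quad v a′ y b)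
      ap {a′} a′∈ same
        with wa′ ← ws-wedge (∈-sel⁻ ws (h (there a′∈)))
        with topped-sameCycle (u≺ wa) (y≺ wa) (u≺ wb) (u≺ wa′) (y≺ wa) (u≺ wb) same
      ... | _ , _ , inj₁ (refl , _) = All.lookup pa a′∈ refl
      ... | _ , _ , inj₂ (refl , _) = new∉ (∈-sel⁻ ws (h (here refl)))
    across : All (λ q → All (Apart q) (quads v ws)) (map (λ a → quad v a y b) (sel y ws))
    across = All.map⁺ (All.tabulate λ {a} a∈ → All.tabulate λ q∈ same → clash a∈ (∈-quads⁻ us q∈) same)
      where
      clash : ∀ {a q} → a ∈ₗ sel y ws →
              ∃[ c ] ∃[ z ] ∃[ d ] (q ≡ quad v c z d × (c , z) ∈ₗ ws × (d , z) ∈ₗ ws × c ≢ d) →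
              Apart (quad v a y b) q
      clash a∈ (c , z , d , refl , c∈ , d∈ , _) same
        with wa ← ws-wedge (∈-sel⁻ ws a∈) | wc ← ws-wedge c∈ | wd ← ws-wedge d∈
        with topped-sameCycle (u≺ wa) (y≺ wa) (u≺ wb) (u≺ wc) (y≺ wc) (u≺ wd) same
      ... | _ , refl , inj₁ (_ , refl) = new∉ d∈
      ... | _ , refl , inj₂ (_ , refl) = new∉ c∈

  reps-apart : ∀ {vs} → Uniqueₗ vs → AllPairs Apart (reps vs)
  reps-apart {[]}     _               = []
  reps-apart {v ∷ vs} uniq@(_ ∷ us) =
    AllPairs.++⁺ (quads-apart (wedges-unique v) ∈-wedges⁻) (reps-apart us)
      (All.tabulate λ q∈ → All.tabulate λ r∈ → clash (quads-topped q∈) (∈-reps⁻ vs r∈))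
    where
    clash : ∀ {q r} → Topped v q → ∃[ w ] (w ∈ₗ vs × Topped w r) → Apart q r
    clash (topped _ wa wb) (w , w∈ , topped _ wc wd) same
      with refl , _ ← topped-sameCycle (u≺ wa) (y≺ wa) (u≺ wb) (u≺ wc) (y≺ wc) (u≺ wd) same =
      Unique.Unique[x∷xs]⇒x∉xs uniq w∈

  Covered : Vec (Fin n) 4 → Set
  Covered s = ∃[ v ] ∃[ q ] (q ∈ₗ quads v (wedges v) × SameCycle s q)

  isC₄-shift : ∀ {s} → IsC₄ G s → IsC₄ G (shift s)
  isC₄-shift {x ∷ y ∷ z ∷ w ∷ []}
    (((x≢y ∷ x≢z ∷ x≢w ∷ []) ∷ (y≢z ∷ y≢w ∷ []) ∷ (z≢w ∷ []) ∷ [] ∷ []) , xy , yz , zw , wx) =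
    ((y≢z ∷ y≢w ∷ (x≢y ∘ sym) ∷ []) ∷ (z≢w ∷ (x≢z ∘ sym) ∷ []) ∷ ((x≢w ∘ sym) ∷ []) ∷ [] ∷ []) ,
    yz , zw , wx , xy

  covered-top : ∀ {v a y b} → IsC₄ G (quad v a y b) → a ≺ v → y ≺ v → b ≺ v → Covered (quad v a y b)
  covered-top (_ ∷ (_ ∷ a≢b ∷ []) ∷ _ , va , ay , yb , bv) a≺ y≺ b≺
    with ∈-quads⁺ (∈-wedges⁺ (isWedge (~⇒nbrs va) (~⇒nbrs ay) a≺ y≺))
                  (∈-wedges⁺ (isWedge (~⇒nbrs (~-sym bv)) (~⇒nbrs (~-sym yb)) b≺ y≺)) a≢b
  ... | inj₁ q∈ = _ , _ , q∈ , here refl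
  -- Exchanging the middle vertices is a reversal followed by three shifts, the last entry of the
  -- orbit.
  ... | inj₂ q∈ = _ , _ , q∈ , there (there (there (there (there (there (there (here refl)))))))

  covered-shift : ∀ {s} → Covered (shift s) → Covered s
  covered-shift {s@(_ ∷ _ ∷ _ ∷ _ ∷ [])} (v , q , q∈ , same) =
    v , q , q∈ , sameCycle-trans {s = s} {t = shift s} (there (here refl)) same

  -- A small tournament: `x` against `y`, `z` against `w`, then the two winners. Shifts bring the
  -- overall winner to the front, where `covered-top` applies.
  covered : ∀ s → IsC₄ G s → Covered s
  covered s@(x ∷ y ∷ z ∷ w ∷ []) c@(((x≢y ∷ x≢z ∷ x≢w ∷ []) ∷ (y≢z ∷ y≢w ∷ []) ∷ (z≢w ∷ []) ∷ _) , _)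
    with ≺-connex x≢y | ≺-connex z≢w
  ... | inj₁ x≺y | inj₁ z≺w with ≺-connex y≢w
  ...   | inj₁ y≺w = covered-shift {s} (covered-shift {shift s} (covered-shift {shift (shift s)}
                       (covered-top (isC₄-shift (isC₄-shift (isC₄-shift c))) (≺-trans x≺y y≺w) y≺w z≺w)))
  ...   | inj₂ w≺y = covered-shift {s} (covered-top (isC₄-shift c) (≺-trans z≺w w≺y) w≺y x≺y)
  covered s@(x ∷ y ∷ z ∷ w ∷ []) c@(((x≢y ∷ x≢z ∷ x≢w ∷ []) ∷ (y≢z ∷ y≢w ∷ []) ∷ (z≢w ∷ []) ∷ _) , _)
      | inj₁ x≺y | inj₂ w≺z with ≺-connex y≢z
  ...   | inj₁ y≺z = covered-shift {s} (covered-shift {shift s}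
                       (covered-top (isC₄-shift (isC₄-shift c)) w≺z (≺-trans x≺y y≺z) y≺z))
  ...   | inj₂ z≺y = covered-shift {s} (covered-top (isC₄-shift c) z≺y (≺-trans w≺z z≺y) x≺y)
  covered s@(x ∷ y ∷ z ∷ w ∷ []) c@(((x≢y ∷ x≢z ∷ x≢w ∷ []) ∷ (y≢z ∷ y≢w ∷ []) ∷ (z≢w ∷ []) ∷ _) , _)
      | inj₂ y≺x | inj₁ z≺w with ≺-connex x≢w
  ...   | inj₁ x≺w = covered-shift {s} (covered-shift {shift s} (covered-shift {shift (shift s)}
                       (covered-top (isC₄-shift (isC₄-shift (isC₄-shift c))) x≺w (≺-trans y≺x x≺w) z≺w)))
  ...   | inj₂ w≺x = covered-top c y≺x (≺-trans z≺w w≺x) w≺x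
  covered s@(x ∷ y ∷ z ∷ w ∷ []) c@(((x≢y ∷ x≢z ∷ x≢w ∷ []) ∷ (y≢z ∷ y≢w ∷ []) ∷ (z≢w ∷ []) ∷ _) , _)
      | inj₂ y≺x | inj₂ w≺z with ≺-connex x≢z
  ...   | inj₁ x≺z = covered-shift {s} (covered-shift {shift s}
                       (covered-top (isC₄-shift (isC₄-shift c)) w≺z x≺z (≺-trans y≺x x≺z)))
  ...   | inj₂ z≺x = covered-top c y≺x z≺x (≺-trans w≺z z≺x)

  ∈-allVecs : ∀ {k} (s : Vec (Fin n) k) → s ∈ₗ allVecs n k
  ∈-allVecs []      = here refl
  ∈-allVecs (x ∷ s) = ∈-cartesianProductWith⁺ _∷_ (∈-allFin x) (∈-allVecs s)

  -- Both the deduplicated list of the definition of □ and reps contain exactly one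
  -- representative of every cycle through x.
  □≡sumBy-mult : ∀ {vs} → Uniqueₗ vs → (∀ v → v ∈ₗ vs) → ∀ x → sumBy (mult x) (reps vs) ≡ □ G x
  □≡sumBy-mult {vs} uniq all x =
    trans (sumBy-mult x (All.tabulate (λ q∈ → proj₁ (topped-isC₄ (proj₂ (proj₂ (∈-reps⁻ vs q∈)))))))
          (ℕ.≤-antisym
            (length-cover here′ there′ (separate (AllPairs.filter⁺ (x ∈?_) (reps-apart uniq))) to)
            (length-cover there′ here′ (separate (deduplicate-separated same? cands)) from))
    where
    open VecMembership (_≟_ {n}) using (_∈?_)
    same? = sameCycle? (_≟_ {n})
    cand? = λ s → isC₄? G s ×-dec (x ∈? s)
    cands = filter cand? (allVecs n 4)
    here′ = filter (x ∈?_) (reps vs)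
    there′ = deduplicate same? cands
    separate : ∀ {qs} → AllPairs Apart qs → AllPairs (λ q q′ → ∀ r → SameCycle q r → ¬ SameCycle q′ r) qs
    separate = AllPairs.map λ {q} {q′} apart r q∼r q′∼r →
      apart (sameCycle-trans {s = q} {t = r} q∼r (sameCycle-sym {s = q′} q′∼r))
    to : ∀ {q} → q ∈ₗ here′ → ∃[ r ] (r ∈ₗ there′ × SameCycle q r)
    to {q} q∈ with q∈reps , x∈ ← ∈-filter⁻ (x ∈?_) {xs = reps vs} q∈
      with _ , _ , t ← ∈-reps⁻ vs q∈reps
      with r , r∈ , same ← deduplicate-covers same? (λ {s} → sameCycle-refl {s = s}) (λ {s} {t} → sameCycle-trans {s = s} {t = t}) cands
             (∈-filter⁺ cand? (∈-allVecs q) (topped-isC₄ t , x∈)) =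
      r , r∈ , sameCycle-sym {s = r} same
    from : ∀ {r} → r ∈ₗ there′ → ∃[ q ] (q ∈ₗ here′ × SameCycle r q)
    from {r} r∈ with _ , c , x∈ ← ∈-filter⁻ cand? {xs = allVecs n 4} (deduplicate⁻ same? r∈)
      with v , q , q∈ , same ← covered r c =
      q , ∈-filter⁺ (x ∈?_) (∈-reps⁺ (all v) q∈) (sameCycle-∈ {s = r} same x∈) , same

-- Total correctness with time bounds, and a loop rule.

module Execution {n} {G : Graph n} (A : AdjacencyLists G) (W : ℕ) {k s : ℕ} where

  record Exec (P : Program k) (σ : State k s) (T : ℕ) (Post : State k s → Set) : Set where
    constructor exec
    field
      {time}  : ℕ
      {final} : State k s
      run     : Run A W P σ time final
      time≤   : time ≤ T
      post    : Post final

  module _ {σ : State k s} where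

    done : ∀ {P t τ} {Post : State k s → Set} → Run A W P σ t τ → Post τ → Exec P σ t Post
    done run = exec run ℕ.≤-refl

    relax : ∀ {P T T′ Post} → T ≤ T′ → Exec P σ T Post → Exec P σ T′ Post
    relax T≤ (exec run t≤ post) = exec run (ℕ.≤-trans t≤ T≤) post

    mapPost : ∀ {P T} {Post Post′ : State k s → Set} → (∀ {τ} → Post τ → Post′ τ) → Exec P σ T Post → Exec P σ T Post′
    mapPost f (exec run t≤ post) = exec run t≤ (f post)

    infixr 4 _◂_ _»_

    _◂_ : ∀ {P Q t τ T Post} → Run A W P σ t τ → Exec Q τ T Post → Exec (P ⨾ Q) σ (t + T) Post
    r ◂ exec run t≤ post = exec (r ⨾ run) (ℕ.+-monoʳ-≤ _ t≤) post

    _»_ : ∀ {P Q T T′ Mid Post} → Exec P σ T Mid → (∀ {τ} → Mid τ → Exec Q τ T′ Post) →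
          Exec (P ⨾ Q) σ (T + T′) Post
    exec r₁ t₁≤ mid » next with exec r₂ t₂≤ post ← next mid = exec (r₁ ⨾ r₂) (ℕ.+-mono-≤ t₁≤ t₂≤) post

  -- The invariant is indexed by the elements already processed, newest first, so an iteration is a
  -- `_∷_` and the length of the index is the loop counter. Each iteration pays one step for its
  -- test, and the failing test at the end one more.
  module _ {X : Set} {P : Program k} {r q : Fin k} (xs : List X) (Inv : List X → State k s → Set) (T : X → ℕ)
    (guard : ∀ {acc σ} → Inv acc σ → lookup (regs σ) r ≡ length acc × lookup (regs σ) q ≡ length xs)
    (step : ∀ i {acc σ} → length acc ≡ toℕ i → Inv acc σ →
            Exec P σ (T (List.lookup xs i)) (Inv (List.lookup xs i ∷ acc)))
    where

    private
      go : ∀ acc rest {σ} → acc ʳ++ rest ≡ xs → Inv acc σ →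
           Exec (while r < q loop P) σ (suc (sumBy (suc ∘ T) rest)) (Inv (reverse xs))
      go acc [] {σ} refl inv = done (while-stop stop) (subst (λ ys → Inv ys _) (sym rev) inv)
        where
        rev : reverse (acc ʳ++ []) ≡ acc
        rev = reverse-involutive acc
        stop : ¬ (lookup (regs σ) r < lookup (regs σ) q)
        stop lt with e , f ← guard {acc} inv =
          ℕ.<-irrefl (sym (length-reverse acc)) (subst₂ _<_ e f lt)
      go acc (x ∷ rest) {σ} refl inv
        with i , i≡ , look ← lookup-ʳ++ acc (x ∷ rest) 0F
        with i≡ ← trans i≡ (ℕ.+-identityʳ (length acc))
        with exec r₁ t₁≤ mid ← step i (sym i≡) inv
        rewrite look
        with exec r₂ t₂≤ post ← go (x ∷ acc) rest refl mid =
        exec (while-step lt r₁ r₂)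
             (s≤s (ℕ.≤-trans (ℕ.+-mono-≤ t₁≤ t₂≤) (ℕ.≤-reflexive (ℕ.+-suc (T x) (sumBy (suc ∘ T) rest))))) post
        where
        lt : lookup (regs σ) r < lookup (regs σ) q
        lt with e , f ← guard {acc} inv = subst₂ _<_ (trans i≡ (sym e)) (sym f) (toℕ<n i)

    forEach : ∀ {σ} → Inv [] σ → Exec (while r < q loop P) σ (suc (sumBy (suc ∘ T) xs)) (Inv (reverse xs))
    forEach = go [] xs refl

-- The program.

rZero rOne rSize rV rDv rI rU rDu rJ rY rDy rAddr rOld rNew : Fin 14
rZero = # 0
rOne  = # 1
rSize = # 2
rV    = # 3
rDv   = # 4
rI    = # 5
rU    = # 6
rDu   = # 7
rJ    = # 8
rY    = # 9
rDy   = # 10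
rAddr = # 11
rOld  = # 12
rNew  = # 13

-- Decides `≺` by strict comparisons alone: degrees are equal when both comparisons fail, and only
-- then do the labels decide.
whenBelow : (r dr : Fin 14) → Program 14 → Program 14
whenBelow r dr P =
  if dr < rDv then P else
  if rDv < dr then skip else
  if r < rV then P else skip

tally : Program 14
tally =
  rAddr ≔ rY ⊕ rSize ⨾
  rOld ≔ load rAddr ⨾
  rNew ≔ rOld ⊕ rOne ⨾
  store rAddr rNew ⨾
  rAddr ≔ rAddr ⊕ rSize ⨾
  store rAddr rOld ⨾
  rNew ≔ load rY ⨾
  rNew ≔ rNew ⊕ rOld ⨾
  store rY rNew ⨾
  rNew ≔ load rV ⨾
  rNew ≔ rNew ⊕ rOld ⨾
  store rV rNew ⨾
  rAddr ≔ lit 0 ⨾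
  rOld ≔ lit 0 ⨾
  rNew ≔ lit 0

settle : Program 14
settle =
  rAddr ≔ rY ⊕ rSize ⨾
  store rAddr rZero ⨾
  rAddr ≔ rAddr ⊕ rSize ⨾
  rOld ≔ load rAddr ⨾
  rNew ≔ load rU ⨾
  rNew ≔ rNew ⊕ rOld ⨾
  store rU rNew ⨾
  rAddr ≔ lit 0 ⨾
  rOld ≔ lit 0 ⨾
  rNew ≔ lit 0

stepY fanLoop stepU scan : Program 14 → Program 14
stepY body =
  rY ≔ nbr rU rJ ⨾
  rDy ≔ deg rY ⨾
  whenBelow rY rDy body ⨾
  rY ≔ lit 0 ⨾
  rDy ≔ lit 0 ⨾
  rJ ≔ rJ ⊕ rOne

fanLoop body =
  (while rJ < rDu loop stepY body) ⨾
  rJ ≔ lit 0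

stepU body =
  rU ≔ nbr rV rI ⨾
  rDu ≔ deg rU ⨾
  whenBelow rU rDu (fanLoop body) ⨾
  rU ≔ lit 0 ⨾
  rDu ≔ lit 0 ⨾
  rI ≔ rI ⊕ rOne

scan body =
  (while rI < rDv loop stepU body) ⨾
  rI ≔ lit 0

stepV count-C₄ : Program 14
stepV =
  rDv ≔ deg rV ⨾
  scan tally ⨾
  scan settle ⨾
  rDv ≔ lit 0 ⨾
  rV ≔ rV ⊕ rOne

count-C₄ =
  rOne ≔ lit 1 ⨾
  rSize ≔ size ⨾
  (while rV < rSize loop stepV)

-- Bank 0 holds the results, bank 1 the number of wedges seen so far that end in
-- each vertex, bank 2 the value of bank 1 before its last increment.
module Banks (n c′ : ℕ) where

  Mem : Set
  Mem = Vec ℕ ((3 + c′) * n)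

  Bank : Set
  Bank = Fin (3 + c′)

  -- Opaque, so that bank and vertex can be read off an address by unification.
  abstract
    cell : Bank → Fin n → Fin ((3 + c′) * n)
    cell = combine

    toℕ-cell : ∀ k x → toℕ (cell k x) ≡ n * toℕ k + toℕ x
    toℕ-cell k x = toℕ-combine {3 + c′} {n} k x

    cell-injectiveˡ : ∀ k x k′ x′ → cell k x ≡ cell k′ x′ → k ≡ k′
    cell-injectiveˡ = combine-injectiveˡ {3 + c′} {n}

    cell-injectiveʳ : ∀ k x k′ x′ → cell k x ≡ cell k′ x′ → x ≡ x′
    cell-injectiveʳ = combine-injectiveʳ {3 + c′} {n}

  get : Mem → Bank → Fin n → ℕ
  get M k x = lookup M (cell k x)

  put : Mem → Bank → Fin n → ℕ → Mem
  put M k x z = M [ cell k x ]≔ z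

  get-put : ∀ M k y z x → get (put M k y z) k x ≡ (when does (x ≟ y) then z else get M k x)
  get-put M k y z x with x ≟ y
  ... | yes refl = lookup∘update (cell k x) M z
  ... | no x≢y   = lookup∘update′ (x≢y ∘ cell-injectiveʳ k x k y) M z

  get-put-≢ : ∀ M {k k′} y z x → k ≢ k′ → get (put M k y z) k′ x ≡ get M k′ x
  get-put-≢ M {k} {k′} y z x k≢k′ = lookup∘update′ (k≢k′ ∘ sym ∘ cell-injectiveˡ k′ x k y) M z

  get-bump : ∀ M k y z x → get (put M k y (get M k y + z)) k x ≡ get M k x + δ x y * z
  get-bump M k y z x = trans (get-put M k y _ x) bump
    where
    bump : (when does (x ≟ y) then get M k y + z else get M k x) ≡ get M k x + δ x y * z
    bump with x ≟ y
    ... | yes refl = cong (get M k x +_) (sym (ℕ.+-identityʳ z))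
    ... | no  _    = sym (ℕ.+-identityʳ _)

  addr₀ : ∀ x → toℕ (cell 0F x) ≡ toℕ x
  addr₀ x = trans (toℕ-cell 0F x) (cong (_+ toℕ x) (ℕ.*-zeroʳ n))

  addr₁ : ∀ x → toℕ (cell 1F x) ≡ toℕ x + n
  addr₁ x = trans (toℕ-cell 1F x)
    (trans (cong (_+ toℕ x) (ℕ.*-identityʳ n)) (ℕ.+-comm n (toℕ x)))

  addr₂ : ∀ x → toℕ (cell 2F x) ≡ toℕ x + n + n
  addr₂ x = trans (toℕ-cell 2F x) (lemma n (toℕ x))
    where
    lemma : ∀ m k → m * 2 + k ≡ k + m + m
    lemma = solve-∀

-- In the middle of a walk there are at most `n * n` wedges from finished fans and `n` from the
-- current one. A top contributes to a cell at most `3` times the square of this cap: `2` from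
-- `credit₁` and `1` from `credit₂`. The two summands of `countCap` stand for the earlier tops and
-- the current one.
wedgeCap countCap : ℕ → ℕ
wedgeCap n = n + n * n
countCap n = n * (3 * (wedgeCap n * wedgeCap n)) + 3 * (wedgeCap n * wedgeCap n)

-- Invariants of the two loop bodies.

module Correctness {n} {G : Graph n} (A : AdjacencyLists G) (W c′ : ℕ) where
  open AdjacencyLists A
  open Order A
  open IsWedge
  open Banks n c′
  open Execution A W {14} {(3 + c′) * n}

  b : ℕ
  b = wedgeCap n

  -- The last three registers are scratch; every fragment of the program leaves them at 0.
  frame : (v dv i u du j y dy : ℕ) → Vec ℕ 14
  frame v dv i u du j y dy =
    0 ∷ 1 ∷ n ∷ v ∷ dv ∷ i ∷ u ∷ du ∷ j ∷ y ∷ dy ∷ 0 ∷ 0 ∷ 0 ∷ []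

  At : Vec ℕ 14 → (Mem → Set) → State 14 ((3 + c′) * n) → Set
  At ρ I σ = regs σ ≡ ρ × I (mem σ)

  Body : Fin n → Program 14 → ℕ → (List Wedge → Mem → Set) → Set
  Body v P K Inv = ∀ {ws u y M i j} → length ((u , y) ∷ ws) ≤ b → IsWedge v u y → Inv ws M →
    let ρ = frame (toℕ v) (deg′ v) i (toℕ u) (deg′ u) j (toℕ y) (deg′ y) in
    Exec P ⟨ ρ , M ⟩ K (At ρ (Inv ((u , y) ∷ ws)))

  -- `small` covers the wedge counters and the addresses up to bank 2, `count<W` the results. The
  -- extra `b + b` is room for the two additions that `tally` makes to bank 0.
  module Bodies (small : 2 + b + (n + n + n) < W) (count<W : countCap n + (b + b) < W) where

    0<W : 0 < W
    0<W = ℕ.≤-<-trans z≤n small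
    1<W : 1 < W
    1<W = ℕ.≤-<-trans (s≤s z≤n) small
    b+1<W : 1 + b < W
    b+1<W = ℕ.≤-<-trans (ℕ.≤-trans (ℕ.n≤1+n (suc b)) (ℕ.m≤m+n (2 + b) (n + n + n))) small
    3n<W : n + n + n < W
    3n<W = ℕ.≤-<-trans (ℕ.m≤n+m (n + n + n) (2 + b)) small
    2n<W : n + n < W
    2n<W = ℕ.≤-<-trans (ℕ.m≤m+n (n + n) n) 3n<W
    n<W : n < W
    n<W = ℕ.≤-<-trans (ℕ.m≤m+n n n) 2n<W
    ≤n⇒<W : ∀ {x} → x ≤ n → x < W
    ≤n⇒<W x≤n = ℕ.≤-<-trans x≤n n<W
    addr₁<W : ∀ (x : Fin n) → toℕ x + n < W
    addr₁<W x = ℕ.≤-<-trans (ℕ.+-monoˡ-≤ n (ℕ.<⇒≤ (toℕ<n x))) 2n<W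
    addr₂<W : ∀ (x : Fin n) → toℕ x + n + n < W
    addr₂<W x = ℕ.≤-<-trans (ℕ.+-monoˡ-≤ n (ℕ.+-monoˡ-≤ n (ℕ.<⇒≤ (toℕ<n x)))) 3n<W
    ≤countCap⇒<W : ∀ {x} → x ≤ countCap n + (b + b) → x < W
    ≤countCap⇒<W x≤ = ℕ.≤-<-trans x≤ count<W

    module _ (v : Fin n) (C : Fin n → ℕ) (C≤ : ∀ x → C x ≤ n * (3 * (b * b))) where

      -- `C` is what the earlier tops left in bank 0. The field `before` speaks only of ends already
      -- reached: bank 2 is never cleared and may hold values from an earlier top elsewhere.
      record Tallied (ws : List Wedge) (M : Mem) : Set where
        field
          count  : ∀ x → get M 0F x ≡ C x + credit₁ x v ws
          paths  : ∀ y → get M 1F y ≡ occ y ws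
          before : ∀ y → 0 < occ y ws → get M 2F y ≡ pred (occ y ws)

      tally-body : Body v tally 15 Tallied
      tally-body {ws} {u} {y} {M} len≤ w inv = exec
        ((rAddr ≔ (rY ⊕ rSize)) (addr₁<W y) ⨾
         (rOld ≔ load (cell 1F y , addr₁ y , refl)) (ℕ.≤-<-trans L≤b (ℕ.<-trans (ℕ.n<1+n b) b+1<W)) ⨾
         (rNew ≔ (rOld ⊕ rOne)) (ℕ.≤-<-trans (ℕ.≤-trans (ℕ.≤-reflexive (ℕ.+-comm L 1)) (s≤s L≤b)) b+1<W) ⨾
         store rNew (cell 1F y) (addr₁ y) ⨾
         (rAddr ≔ (rAddr ⊕ rSize)) (addr₂<W y) ⨾
         store rOld (cell 2F y) (addr₂ y) ⨾
         (rNew ≔ load (cell 0F y , addr₀ y , refl)) (≤countCap⇒<W (ℕ.≤-trans (M₂≤ y) (ℕ.m≤m+n _ _))) ⨾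
         (rNew ≔ (rNew ⊕ rOld)) (≤countCap⇒<W (ℕ.+-mono-≤ (M₂≤ y) (ℕ.≤-trans L≤b (ℕ.m≤m+n b b)))) ⨾
         store rNew (cell 0F y) (addr₀ y) ⨾
         (rNew ≔ load (cell 0F v , addr₀ v , refl)) (≤countCap⇒<W (ℕ.≤-trans (M₃≤ v) (ℕ.+-monoʳ-≤ (countCap n) (ℕ.m≤m+n b b)))) ⨾
         (rNew ≔ (rNew ⊕ rOld)) (≤countCap⇒<W (ℕ.≤-trans (ℕ.+-mono-≤ (M₃≤ v) L≤b) (ℕ.≤-reflexive (ℕ.+-assoc (countCap n) b b)))) ⨾
         store rNew (cell 0F v) (addr₀ v) ⨾
         (rAddr ≔ lit 0) 0<W ⨾ (rOld ≔ lit 0) 0<W ⨾ (rNew ≔ lit 0) 0<W)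
        ℕ.≤-refl (refl , record { count = count′ ; paths = paths′ ; before = before′ })
        where
        open Tallied inv
        L : ℕ
        L = get M 1F y
        M₁ M₂ M₃ M₄ : Mem
        M₁ = put M 1F y (L + 1)
        M₂ = put M₁ 2F y L
        M₃ = put M₂ 0F y (get M₂ 0F y + L)
        M₄ = put M₃ 0F v (get M₃ 0F v + L)
        len≤′ : length ws ≤ b
        len≤′ = ℕ.≤-trans (ℕ.n≤1+n _) len≤
        L≤b : L ≤ b
        L≤b = ℕ.≤-trans (ℕ.≤-reflexive (paths y)) (ℕ.≤-trans (occ≤length y ws) len≤′)
        M₂≡ : ∀ x → get M₂ 0F x ≡ C x + credit₁ x v ws
        M₂≡ x = trans (get-put-≢ M₁ y L x λ ()) (trans (get-put-≢ M y (L + 1) x λ ()) (count x))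
        M₂≤ : ∀ x → get M₂ 0F x ≤ countCap n
        M₂≤ x = begin
          get M₂ 0F x             ≡⟨ M₂≡ x ⟩
          C x + credit₁ x v ws    ≤⟨ ℕ.+-mono-≤ (C≤ x) (credit₁-≤ x v ws) ⟩
          n * (3 * (b * b)) + length ws * (2 * length ws)
            ≤⟨ ℕ.+-monoʳ-≤ (n * (3 * (b * b))) (ℕ.*-mono-≤ len≤′ (ℕ.*-monoʳ-≤ 2 len≤′)) ⟩
          -- The added `b * b` is the share of the second walk in `countCap`.
          n * (3 * (b * b)) + b * (2 * b)  ≤⟨ ℕ.+-monoʳ-≤ (n * (3 * (b * b))) (ℕ.m≤m+n _ (b * b)) ⟩
          n * (3 * (b * b)) + (b * (2 * b) + b * b) ≡⟨ cong (n * (3 * (b * b)) +_) (lemma b) ⟩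
          countCap n ∎
          where
          open ℕ.≤-Reasoning
          lemma : ∀ k → k * (2 * k) + k * k ≡ 3 * (k * k)
          lemma = solve-∀
        M₃≤ : ∀ x → get M₃ 0F x ≤ countCap n + b
        M₃≤ x = begin
          get M₃ 0F x           ≡⟨ get-bump M₂ 0F y L x ⟩
          get M₂ 0F x + δ x y * L ≤⟨ ℕ.+-mono-≤ (M₂≤ x) (ℕ.*-mono-≤ (δ≤1 x y) L≤b) ⟩
          countCap n + 1 * b      ≡⟨ cong (countCap n +_) (ℕ.*-identityˡ b) ⟩
          countCap n + b          ∎
          where open ℕ.≤-Reasoning
        count′ : ∀ x → get M₄ 0F x ≡ C x + credit₁ x v ((u , y) ∷ ws)
        count′ x = begin
          get M₄ 0F x                             ≡⟨ get-bump M₃ 0F v L x ⟩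
          get M₃ 0F x + δ x v * L                 ≡⟨ cong (_+ δ x v * L) (get-bump M₂ 0F y L x) ⟩
          get M₂ 0F x + δ x y * L + δ x v * L     ≡⟨ cong₂ (λ e l → e + δ x y * l + δ x v * l) (M₂≡ x) (paths y) ⟩
          C x + credit₁ x v ws + δ x y * occ y ws + δ x v * occ y ws
            ≡⟨ lemma (C x) (credit₁ x v ws) (δ x y) (δ x v) (occ y ws) ⟩
          C x + credit₁ x v ((u , y) ∷ ws)        ∎
          where
          open ≡-Reasoning
          lemma : ∀ c k d e l → c + k + d * l + e * l ≡ c + (k + (d + e) * l)
          lemma = solve-∀
        paths′ : ∀ x → get M₄ 1F x ≡ occ x ((u , y) ∷ ws)
        paths′ x = begin
          get M₄ 1F x          ≡⟨ get-put-≢ M₃ v _ x (λ ()) ⟩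
          get M₃ 1F x          ≡⟨ get-put-≢ M₂ y _ x (λ ()) ⟩
          get M₂ 1F x          ≡⟨ get-put-≢ M₁ y L x (λ ()) ⟩
          get M₁ 1F x          ≡⟨ get-bump M 1F y 1 x ⟩
          get M 1F x + δ x y * 1 ≡⟨ cong₂ _+_ (paths x) (ℕ.*-identityʳ (δ x y)) ⟩
          occ x ws + δ x y     ≡⟨ ℕ.+-comm (occ x ws) (δ x y) ⟩
          δ x y + occ x ws     ∎
          where open ≡-Reasoning
        before′ : ∀ x → 0 < occ x ((u , y) ∷ ws) → get M₄ 2F x ≡ pred (occ x ((u , y) ∷ ws))
        before′ x 0< = trans (get-put-≢ M₃ v _ x λ ()) (trans (get-put-≢ M₂ y _ x λ ())
          (trans (get-put M₁ 2F y L x) (cases 0<)))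
          where
          cases : 0 < δ x y + occ x ws → (when does (x ≟ y) then L else get M₁ 2F x) ≡ pred (δ x y + occ x ws)
          cases 0<′ with x ≟ y
          -- Here `occ x` has just grown by one, so its predecessor is the old count `L`.
          ... | yes refl = paths x
          ... | no  _    = trans (get-put-≢ M y (L + 1) x λ ()) (before x 0<′)

      module _ (all : List Wedge) (all≤ : length all ≤ b) (∈all : ∀ {u y} → IsWedge v u y → (u , y) ∈ₗ all) where

        -- The expected counter of an end during the second walk. The first argument is the number
        -- of its wedges already revisited; the first revisit clears the counter, later ones clear
        -- it again.
        reset : ℕ → ℕ → ℕ
        reset zero    l = l
        reset (suc _) l = 0

        record Settled (ws : List Wedge) (M : Mem) : Set where
          field
            count  : ∀ x → get M 0F x ≡ C x + credit₁ x v all + credit₂ x all ws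
            paths  : ∀ y → get M 1F y ≡ reset (occ y ws) (occ y all)
            before : ∀ y → 0 < occ y all → get M 2F y ≡ pred (occ y all)

        settle-body : Body v settle 15 Settled
        settle-body {ws} {u} {y} {M} len≤ w inv = exec
          ((rAddr ≔ (rY ⊕ rSize)) (addr₁<W y) ⨾
           store rZero (cell 1F y) (addr₁ y) ⨾
           (rAddr ≔ (rAddr ⊕ rSize)) (addr₂<W y) ⨾
           (rOld ≔ load (cell 2F y , addr₂ y , refl)) (ℕ.≤-<-trans L≤b (ℕ.<-trans (ℕ.n<1+n b) b+1<W)) ⨾
           (rNew ≔ load (cell 0F u , addr₀ u , refl)) (≤countCap⇒<W (ℕ.≤-trans (M₁≤ u) (ℕ.m≤m+n _ _))) ⨾
           (rNew ≔ (rNew ⊕ rOld)) (≤countCap⇒<W (ℕ.+-mono-≤ (M₁≤ u) (ℕ.≤-trans L≤b (ℕ.m≤m+n b b)))) ⨾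
           store rNew (cell 0F u) (addr₀ u) ⨾
           (rAddr ≔ lit 0) 0<W ⨾ (rOld ≔ lit 0) 0<W ⨾ (rNew ≔ lit 0) 0<W)
          -- Ten steps, padded to the fifteen of `tally` so that one bound serves both walks.
          (ℕ.≤ᵇ⇒≤ 10 15 _) (refl , record { count = count′ ; paths = paths′ ; before = before′ })
          where
          open Settled inv
          M₁ M₂ : Mem
          M₁ = put M 1F y 0
          L : ℕ
          L = get M₁ 2F y
          M₂ = put M₁ 0F u (get M₁ 0F u + L)
          L≡ : L ≡ pred (occ y all)
          -- The wedge at hand ends in `y`, so `y` was reached by the first walk and its cell in
          -- bank 2 is up to date.
          L≡ = trans (get-put-≢ M y 0 y λ ()) (before y (0<occ (∈all w)))
          L≤b : L ≤ b
          L≤b = ℕ.≤-trans (ℕ.≤-reflexive L≡) (ℕ.≤-trans ℕ.pred[n]≤n (ℕ.≤-trans (occ≤length y all) all≤))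
          M₁≤ : ∀ x → get M₁ 0F x ≤ countCap n
          M₁≤ x = begin
            get M₁ 0F x   ≡⟨ get-put-≢ M y 0 x (λ ()) ⟩
            get M 0F x    ≡⟨ count x ⟩
            C x + credit₁ x v all + credit₂ x all ws
              ≤⟨ ℕ.+-mono-≤ (ℕ.+-mono-≤ (C≤ x) (credit₁-≤ x v all)) (credit₂-≤ x all ws) ⟩
            n * (3 * (b * b)) + length all * (2 * length all) + length ws * length all
              ≤⟨ ℕ.+-mono-≤ (ℕ.+-monoʳ-≤ (n * (3 * (b * b))) (ℕ.*-mono-≤ all≤ (ℕ.*-monoʳ-≤ 2 all≤)))
                            (ℕ.*-mono-≤ (ℕ.≤-trans (ℕ.n≤1+n _) len≤) all≤) ⟩
            n * (3 * (b * b)) + b * (2 * b) + b * b ≡⟨ lemma (n * (3 * (b * b))) b ⟩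
            countCap n ∎
            where
            open ℕ.≤-Reasoning
            lemma : ∀ m k → m + k * (2 * k) + k * k ≡ m + 3 * (k * k)
            lemma = solve-∀
          count′ : ∀ x → get M₂ 0F x ≡ C x + credit₁ x v all + credit₂ x all ((u , y) ∷ ws)
          count′ x = begin
            get M₂ 0F x             ≡⟨ get-bump M₁ 0F u L x ⟩
            get M₁ 0F x + δ x u * L ≡⟨ cong₂ (λ e l → e + δ x u * l) (trans (get-put-≢ M y 0 x λ ()) (count x)) L≡ ⟩
            C x + credit₁ x v all + credit₂ x all ws + δ x u * pred (occ y all)
              ≡⟨ lemma (C x + credit₁ x v all) _ _ ⟩
            C x + credit₁ x v all + credit₂ x all ((u , y) ∷ ws) ∎
            where
            open ≡-Reasoning
            lemma : ∀ c k l → c + k + l ≡ c + (l + k)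
            lemma = solve-∀
          paths′ : ∀ x → get M₂ 1F x ≡ reset (occ x ((u , y) ∷ ws)) (occ x all)
          paths′ x = trans (get-put-≢ M₁ u _ x λ ()) (trans (get-put M 1F y 0 x) cases)
            where
            cases : (when does (x ≟ y) then 0 else get M 1F x) ≡ reset (δ x y + occ x ws) (occ x all)
            cases with x ≟ y
            ... | yes _ = refl
            ... | no  _ = paths x
          before′ : ∀ x → 0 < occ x all → get M₂ 2F x ≡ pred (occ x all)
          before′ x 0< = trans (get-put-≢ M₁ u _ x λ ()) (trans (get-put-≢ M y 0 x λ ()) (before x 0<))

-- The nested loops over the wedges of one top.

module Scanning {n} {G : Graph n} (A : AdjacencyLists G) (W c′ : ℕ)
  (small : 2 + wedgeCap n + (n + n + n) < W) (count<W : countCap n + (wedgeCap n + wedgeCap n) < W) where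
  open AdjacencyLists A
  open Order A
  open IsWedge
  open Banks n c′
  open Execution A W {14} {(3 + c′) * n}
  open Correctness A W c′
  open Bodies small count<W

  deg′≤n : ∀ v → deg′ v ≤ n
  deg′≤n v = ℕ.≤-trans (length-⊆ (unique v) (λ {u} _ → ∈-allFin u))
                       (ℕ.≤-reflexive (length-allFin n))

  -- The longest paths make three tests and then run `P` or `skip`; the `4` covers the latter even
  -- for `T = 0`.
  whenBelow-exec : ∀ {r dr P σ T Post} u v →
    lookup (regs σ) r ≡ toℕ u → lookup (regs σ) dr ≡ deg′ u →
    lookup (regs σ) rV ≡ toℕ v → lookup (regs σ) rDv ≡ deg′ v →
    (u ≺ v → Exec P σ T Post) → (¬ (u ≺ v) → Post σ) → Exec (whenBelow r dr P) σ (4 + T) Post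
  whenBelow-exec {T = T} u v r≡ dr≡ v≡ dv≡ yes-case no-case
    with deg′ u ℕ.<? deg′ v | deg′ v ℕ.<? deg′ u | toℕ u ℕ.<? toℕ v
  ... | yes p | _ | _ with exec run t≤ post ← yes-case (inj₁ p) =
    exec (if-yes (subst₂ _<_ (sym dr≡) (sym dv≡) p) run) (s≤s (ℕ.≤-trans t≤ (ℕ.m≤n+m T 3))) post
  ... | no ¬p | yes q | _ =
    exec (if-no (¬p ∘ subst₂ _<_ dr≡ dv≡) (if-yes (subst₂ _<_ (sym dv≡) (sym dr≡) q) skip))
         (s≤s (s≤s (s≤s z≤n)))
         (no-case λ { (inj₁ p) → ¬p p ; (inj₂ (e , _)) → ℕ.<-irrefl (sym e) q })
  ... | no ¬p | no ¬q | yes u<v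
    with exec run t≤ post ← yes-case (inj₂ (ℕ.≤-antisym (ℕ.≮⇒≥ ¬q) (ℕ.≮⇒≥ ¬p) , u<v)) =
    exec (if-no (¬p ∘ subst₂ _<_ dr≡ dv≡) (if-no (¬q ∘ subst₂ _<_ dv≡ dr≡)
           (if-yes (subst₂ _<_ (sym r≡) (sym v≡) u<v) run)))
         (s≤s (s≤s (s≤s (ℕ.≤-trans t≤ (ℕ.n≤1+n T))))) post
  ... | no ¬p | no ¬q | no u≮v =
    exec (if-no (¬p ∘ subst₂ _<_ dr≡ dv≡) (if-no (¬q ∘ subst₂ _<_ dv≡ dr≡)
           (if-no (u≮v ∘ subst₂ _<_ r≡ v≡) skip)))
         (s≤s (s≤s (s≤s (s≤s z≤n))))
         (no-case λ { (inj₁ p) → ¬p p ; (inj₂ (_ , u<v)) → u≮v u<v })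

  length-fan : ∀ v u → length (fan v u) ≤ n
  length-fan v u with u ≺? v
  ... | yes _ = ℕ.≤-trans (length-filter (_≺? v) (reverse (nbrs u)))
                          (ℕ.≤-trans (ℕ.≤-reflexive (length-reverse (nbrs u))) (deg′≤n u))
  ... | no  _ = z≤n

  length-wedges : ∀ v → length (wedges v) ≤ b
  length-wedges v = ℕ.≤-trans (length-pairsOf (fan v) (reverse (nbrs v)) (length-fan v))
    (ℕ.≤-trans (ℕ.*-monoˡ-≤ n (ℕ.≤-trans (ℕ.≤-reflexive (length-reverse (nbrs v))) (deg′≤n v)))
               (ℕ.m≤n+m (n * n) n))

  -- Not simplified, so that it agrees definitionally with the sum that `_◂_` and `_»_` assemble;
  -- the same goes for the other time functions.
  visitTime : ℕ → ℕ
  visitTime K = 1 + (1 + ((4 + K) + (1 + (1 + 1))))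

  -- The loop over the neighbours of `u` runs only if `u ≺ v`, when `deg′ u` is the minimum of the
  -- two degrees. Otherwise the cost is constant, so the minimum is a valid bound in both cases.
  fanTime : ℕ → Fin n → Fin n → ℕ
  fanTime K v u = 1 + (1 + ((4 + (suc ((deg′ u ⊓ deg′ v) * suc (visitTime K)) + 1)) + (1 + (1 + 1))))

  scanTime : ℕ → Fin n → ℕ
  scanTime K v = suc (sumBy (λ u → suc (fanTime K v u)) (nbrs v)) + 1

  module _ {v : Fin n} {body : Program 14} {K : ℕ} {Inv : List Wedge → Mem → Set} (bodyExec : Body v body K Inv) where

    private
      scanFrame : ℕ → Vec ℕ 14
      scanFrame i = frame (toℕ v) (deg′ v) i 0 0 0 0 0

      fanFrame : ℕ → Fin n → ℕ → Vec ℕ 14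
      fanFrame i u j = frame (toℕ v) (deg′ v) i (toℕ u) (deg′ u) j 0 0

      suc<W : ∀ {x y} → x < y → y ≤ n → x + 1 < W
      suc<W x<y y≤n = ≤n⇒<W (ℕ.≤-trans (ℕ.≤-reflexive (ℕ.+-comm _ 1)) (ℕ.≤-trans x<y y≤n))

      module _ {u : Fin n} (u∈ : u ∈ₗ nbrs v) (u≺v : u ≺ v) (i : ℕ) (ws : List (Wedge {n})) (ws≤ : length ws ≤ n * n) where

        reached : List (Fin n) → List Wedge
        reached ys = map (u ,_) (filter (_≺? v) ys) ++ ws

        length-reached : ∀ ys → length (reached ys) ≤ length ys + length ws
        length-reached ys = ℕ.≤-trans
          (ℕ.≤-reflexive (trans (length-++ (map (u ,_) (filter (_≺? v) ys)))
                                (cong (_+ length ws) (length-map (u ,_) (filter (_≺? v) ys)))))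
          (ℕ.+-monoˡ-≤ (length ws) (length-filter (_≺? v) ys))

        FanInv : List (Fin n) → State 14 ((3 + c′) * n) → Set
        FanInv ys = At (fanFrame i u (length ys)) (Inv (reached ys))

        visit : ∀ j {ys σ} → length ys ≡ toℕ j → FanInv ys σ →
          Exec (stepY body) σ (visitTime K) (FanInv (List.lookup (nbrs u) j ∷ ys))
        visit j {ys} {⟨ _ , M ⟩} len (refl , inv) =
          (rY ≔ nbr u j refl (sym len)) (≤n⇒<W (ℕ.<⇒≤ (toℕ<n y))) ◂
          (rDy ≔ deg y refl) (≤n⇒<W (deg′≤n y)) ◂
          whenBelow-exec {Post = At (frame (toℕ v) (deg′ v) i (toℕ u) (deg′ u) (length ys) (toℕ y) (deg′ y)) (Inv (reached (y ∷ ys)))}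
            y v refl refl refl refl
            (λ y≺v → mapPost (λ { {⟨ _ , M′ ⟩} (ρ≡ , inv′) → ρ≡ , subst (λ zs → Inv zs M′) (sym (accept y≺v)) inv′ })
              (bodyExec (len≤ y≺v) (isWedge u∈ (∈-lookup j) u≺v y≺v) inv))
            (λ y⊀v → refl , subst (λ zs → Inv (map (u ,_) zs ++ ws) M) (sym (filter-reject (_≺? v) y⊀v)) inv) »
          λ { {⟨ _ , _ ⟩} (refl , inv′) →
            (rY ≔ lit 0) 0<W ◂ (rDy ≔ lit 0) 0<W ◂
            done ((rJ ≔ (rJ ⊕ rOne)) (suc<W (subst (_< deg′ u) (sym len) (toℕ<n j)) (deg′≤n u)))
                 (cong (fanFrame i u) (ℕ.+-comm (length ys) 1) , inv′) }
          where
          y : Fin n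
          y = List.lookup (nbrs u) j
          accept : y ≺ v → reached (y ∷ ys) ≡ (u , y) ∷ reached ys
          accept y≺v = cong (λ zs → map (u ,_) zs ++ ws) (filter-accept (_≺? v) y≺v)
          len≤ : y ≺ v → length ((u , y) ∷ reached ys) ≤ b
          len≤ y≺v = begin
            suc (length (reached ys))     ≤⟨ s≤s (length-reached ys) ⟩
            suc (length ys + length ws)   ≤⟨ ℕ.+-mono-≤ (subst (_≤ n) (cong suc (sym len)) (ℕ.≤-trans (toℕ<n j) (deg′≤n u))) ws≤ ⟩
            b                             ∎
            where open ℕ.≤-Reasoning

        fan-exec : ∀ {M} → Inv ws M →
          Exec (fanLoop body) ⟨ fanFrame i u 0 , M ⟩ (suc (sumBy (λ _ → suc (visitTime K)) (nbrs u)) + 1)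
               (At (fanFrame i u 0) (Inv (reached (reverse (nbrs u)))))
        fan-exec inv =
          forEach (nbrs u) FanInv (λ _ → visitTime K) (λ { {acc} {⟨ _ , _ ⟩} (refl , _) → refl , refl }) visit (refl , inv) »
          λ { {⟨ _ , _ ⟩} (refl , inv′) → done ((rJ ≔ lit 0) 0<W) (refl , inv′) }

      ScanInv : List (Fin n) → State 14 ((3 + c′) * n) → Set
      ScanInv us = At (scanFrame (length us)) (Inv (pairsOf (fan v) us))

      fan-step : ∀ i {us σ} → length us ≡ toℕ i → ScanInv us σ → Exec (stepU body) σ (fanTime K v (List.lookup (nbrs v) i))
                 (ScanInv (List.lookup (nbrs v) i ∷ us))
      fan-step i {us} {⟨ _ , M ⟩} len (refl , inv) =
        (rU ≔ nbr v i refl (sym len)) (≤n⇒<W (ℕ.<⇒≤ (toℕ<n u))) ◂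
        (rDu ≔ deg u refl) (≤n⇒<W (deg′≤n u)) ◂
        whenBelow-exec {Post = At (fanFrame (length us) u 0) (Inv (pairsOf (fan v) (u ∷ us)))}
          u v refl refl refl refl
          (λ u≺v → relax (time≤ u≺v) (mapPost
            (λ { {⟨ _ , M′ ⟩} (ρ≡ , inv′) → ρ≡ ,
              subst (λ zs → Inv (map (u ,_) zs ++ pairsOf (fan v) us) M′) (sym (fan-yes u≺v)) inv′ })
            (fan-exec (∈-lookup i) u≺v (length us) (pairsOf (fan v) us) len≤ inv)))
          (λ u⊀v → refl , subst (λ zs → Inv (map (u ,_) zs ++ pairsOf (fan v) us) M) (sym (fan-no u⊀v)) inv) »
        λ { {⟨ _ , _ ⟩} (refl , inv′) →
          (rU ≔ lit 0) 0<W ◂ (rDu ≔ lit 0) 0<W ◂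
          done ((rI ≔ (rI ⊕ rOne)) (suc<W (subst (_< deg′ v) (sym len) (toℕ<n i)) (deg′≤n v)))
               (cong scanFrame (ℕ.+-comm (length us) 1) , inv′) }
        where
        u : Fin n
        u = List.lookup (nbrs v) i
        fan-yes : u ≺ v → fan v u ≡ filter (_≺? v) (reverse (nbrs u))
        fan-yes u≺v rewrite dec-true (u ≺? v) u≺v = refl
        fan-no : ¬ (u ≺ v) → fan v u ≡ []
        fan-no u⊀v rewrite dec-false (u ≺? v) u⊀v = refl
        len≤ : length (pairsOf (fan v) us) ≤ n * n
        len≤ = ℕ.≤-trans (length-pairsOf (fan v) us (length-fan v))
          (ℕ.*-monoˡ-≤ n (subst (_≤ n) (sym len) (ℕ.≤-trans (ℕ.<⇒≤ (toℕ<n i)) (deg′≤n v))))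
        time≤ : u ≺ v → suc (sumBy (λ _ → suc (visitTime K)) (nbrs u)) + 1 ≤
                suc ((deg′ u ⊓ deg′ v) * suc (visitTime K)) + 1
        time≤ u≺v = ℕ.≤-reflexive (cong (λ e → suc e + 1)
          (trans (sumBy-const (suc (visitTime K)) (nbrs u))
                 (cong (_* suc (visitTime K)) (sym (ℕ.m≤n⇒m⊓n≡m (≺⇒deg≤ u≺v))))))

    scan-exec : ∀ {M} → Inv [] M → Exec (scan body) ⟨ scanFrame 0 , M ⟩ (scanTime K v) (At (scanFrame 0) (Inv (wedges v)))
    scan-exec inv =
      forEach (nbrs v) ScanInv (λ u → fanTime K v u) (λ { {acc} {⟨ _ , _ ⟩} (refl , _) → refl , refl }) fan-step (refl , inv) »
      λ { {⟨ _ , _ ⟩} (refl , inv′) → done ((rI ≔ lit 0) 0<W) (refl , inv′) }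

-- The index lives in `Fin` of the length of the tabulated list and not in `Fin n`; comparing
-- through `toℕ` avoids a cast.
lookup-tabulate⁻ : ∀ {X : Set} {n} (f : Fin n → X) i →
                   ∃[ j ] (toℕ j ≡ toℕ i × List.lookup (List.tabulate f) i ≡ f j)
lookup-tabulate⁻ {n = suc n} f zero    = zero , refl , refl
lookup-tabulate⁻ {n = suc n} f (suc i) with j , j≡ , look ← lookup-tabulate⁻ (f ∘ suc) i =
  suc j , cong suc j≡ , look

-- Correctness of the whole program.

module Counting {n} {G : Graph n} (A : AdjacencyLists G) (W c′ : ℕ)
  (small : 2 + wedgeCap n + (n + n + n) < W) (count<W : countCap n + (wedgeCap n + wedgeCap n) < W) where
  open AdjacencyLists A
  open Order A
  open Banks n c′
  open Execution A W {14} {(3 + c′) * n}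
  open Correctness A W c′
  open Bodies small count<W
  open Scanning A W c′ small count<W

  -- Bounds the results accumulated from earlier tops, so that bank 0 cannot overflow; `credit`
  -- turns the bounds on the two walks into one on the cycles.
  sumBy-reps≤ : ∀ x vs → sumBy (mult x) (reps vs) ≤ length vs * (3 * (b * b))
  sumBy-reps≤ x []       = z≤n
  sumBy-reps≤ x (v ∷ vs) = begin
    sumBy (mult x) (quads v ws ++ reps vs)                  ≡⟨ sumBy-++ (mult x) (quads v ws) (reps vs) ⟩
    sumBy (mult x) (quads v ws) + sumBy (mult x) (reps vs)  ≤⟨ ℕ.+-mono-≤ quads≤ (sumBy-reps≤ x vs) ⟩
    3 * (b * b) + length vs * (3 * (b * b))                 ∎
    where
    open ℕ.≤-Reasoning
    ws : List Wedge
    ws = wedges v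
    lemma : ∀ k → k * (2 * k) + k * k ≡ 3 * (k * k)
    lemma = solve-∀
    quads≤ : sumBy (mult x) (quads v ws) ≤ 3 * (b * b)
    quads≤ = begin
      sumBy (mult x) (quads v ws)         ≡⟨ credit x v ws ⟨
      credit₁ x v ws + credit₂ x ws ws    ≤⟨ ℕ.+-mono-≤ (credit₁-≤ x v ws) (credit₂-≤ x ws ws) ⟩
      length ws * (2 * length ws) + length ws * length ws ≡⟨ lemma (length ws) ⟩
      3 * (length ws * length ws)
        ≤⟨ ℕ.*-monoʳ-≤ 3 (ℕ.*-mono-≤ (length-wedges v) (length-wedges v)) ⟩
      3 * (b * b)                         ∎

  -- Bank 1 must be clean when the next top starts; bank 2 is left unconstrained.
  record Counted (vs : List (Fin n)) (M : Mem) : Set where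
    field
      count : ∀ x → get M 0F x ≡ sumBy (mult x) (reps vs)
      paths : ∀ y → get M 1F y ≡ 0

  private
    vertexFrame : ℕ → Vec ℕ 14
    vertexFrame v = frame v 0 0 0 0 0 0 0

  vertexTime : Fin n → ℕ
  vertexTime v = 1 + (scanTime 15 v + (scanTime 15 v + (1 + 1)))

  stepV-exec : ∀ v {k vs M} → k ≡ toℕ v → length vs ≤ n → Counted vs M →
               Exec stepV ⟨ vertexFrame k , M ⟩ (vertexTime v) (At (vertexFrame (suc k)) (Counted (v ∷ vs)))
  stepV-exec v {vs = vs} refl len≤ inv =
    (rDv ≔ deg v refl) (≤n⇒<W (deg′≤n v)) ◂
    scan-exec {Inv = Tallied v C C≤} (tally-body v C C≤) tallied₀ »
    λ { {⟨ _ , M₁ ⟩} (refl , tallied) →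
      scan-exec {Inv = Settled v C C≤ ws (length-wedges v) ∈-wedges⁺} (settle-body v C C≤ ws (length-wedges v) ∈-wedges⁺) (settled₀ tallied) »
      λ { {⟨ _ , M₂ ⟩} (refl , settled) →
        (rDv ≔ lit 0) 0<W ◂
        done ((rV ≔ (rV ⊕ rOne)) (≤n⇒<W (subst (_≤ n) (ℕ.+-comm 1 (toℕ v)) (toℕ<n v))))
             (cong vertexFrame (ℕ.+-comm (toℕ v) 1) , counted settled) } }
    where
    open Counted inv
    ws : List Wedge
    ws = wedges v
    C : Fin n → ℕ
    C x = sumBy (mult x) (reps vs)
    C≤ : ∀ x → C x ≤ n * (3 * (b * b))
    C≤ x = ℕ.≤-trans (sumBy-reps≤ x vs) (ℕ.*-monoˡ-≤ (3 * (b * b)) len≤)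
    tallied₀ : Tallied v C C≤ [] _
    tallied₀ = record
      { count  = λ x → trans (count x) (sym (ℕ.+-identityʳ (C x)))
      ; paths  = paths
      ; before = λ _ ()
      }
    settled₀ : ∀ {M} → Tallied v C C≤ ws M → Settled v C C≤ ws (length-wedges v) ∈-wedges⁺ [] M
    settled₀ t = record
      { count  = λ x → trans (Tallied.count t x) (sym (ℕ.+-identityʳ _))
      ; paths  = Tallied.paths t
      ; before = Tallied.before t
      }
    counted : ∀ {M} → Settled v C C≤ ws (length-wedges v) ∈-wedges⁺ ws M → Counted (v ∷ vs) M
    counted {M} s = record { count = count′ ; paths = λ y → trans (Settled.paths s y) (cleared (occ y ws)) }
      where
      open ≡-Reasoning
      -- At the end of the second walk the reached counters have been reset, and the others were
      -- never raised.
      cleared : ∀ k → reset v C C≤ ws (length-wedges v) ∈-wedges⁺ k k ≡ 0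
      cleared zero    = refl
      cleared (suc _) = refl
      count′ : ∀ x → get M 0F x ≡ sumBy (mult x) (reps (v ∷ vs))
      count′ x = begin
        get M 0F x                                ≡⟨ Settled.count s x ⟩
        C x + credit₁ x v ws + credit₂ x ws ws    ≡⟨ ℕ.+-assoc (C x) _ _ ⟩
        C x + (credit₁ x v ws + credit₂ x ws ws)  ≡⟨ cong (C x +_) (credit x v ws) ⟩
        C x + sumBy (mult x) (quads v ws)         ≡⟨ ℕ.+-comm (C x) _ ⟩
        sumBy (mult x) (quads v ws) + C x         ≡⟨ sumBy-++ (mult x) (quads v ws) (reps vs) ⟨
        sumBy (mult x) (reps (v ∷ vs))            ∎

  totalTime : ℕ
  totalTime = 1 + (1 + suc (sumBy (λ v → suc (vertexTime v)) (allFin n)))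

  count-C₄-exec : Exec count-C₄ initial totalTime (λ τ → ∀ v → get (mem τ) 0F v ≡ □ G v)
  count-C₄-exec =
    (rOne ≔ lit 1) 1<W ◂
    (rSize ≔ size) n<W ◂
    -- The loop ends with the vertices listed in reverse; any enumeration without repetition serves
    -- for `□≡sumBy-mult`.
    mapPost (λ { {⟨ _ , _ ⟩} (_ , counted) v → trans (Counted.count counted v)
                 (□≡sumBy-mult (reverse-unique (Unique.allFin⁺ n)) (λ u → reverse⁺ (∈-allFin u)) v) })
      (forEach (allFin n) VertexInv vertexTime (λ { {acc} {⟨ _ , _ ⟩} (refl , _) → refl , sym (length-allFin n) }) step
        (refl , record { count = zeroed 0F ; paths = zeroed 1F }))
    where
    VertexInv : List (Fin n) → State 14 ((3 + c′) * n) → Set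
    VertexInv vs = At (vertexFrame (length vs)) (Counted vs)
    zeroed : ∀ k x → get (mem {14} {(3 + c′) * n} initial) k x ≡ 0
    zeroed k x = lookup-replicate (cell k x) 0
    toℕ-lookup : ∀ i → toℕ (List.lookup (allFin n) i) ≡ toℕ i
    toℕ-lookup i with j , j≡ , look ← lookup-tabulate⁻ {n = n} (λ x → x) i = trans (cong toℕ look) j≡
    step : ∀ i {vs σ} → length vs ≡ toℕ i → VertexInv vs σ →
           Exec stepV σ (vertexTime (List.lookup (allFin n) i)) (VertexInv (List.lookup (allFin n) i ∷ vs))
    step i {vs} {⟨ _ , _ ⟩} len (refl , inv) = stepV-exec _ (trans len (sym (toℕ-lookup i)))
      (subst₂ _≤_ (sym len) (length-allFin n) (ℕ.<⇒≤ (toℕ<n i))) inv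

-- The running time in terms of minimum degrees over edges.

module Cost {n} {G : Graph n} (A : AdjacencyLists G) where
  open Graph G
  open AdjacencyLists A
  open Order A

  d≡deg′ : ∀ v → d v ≡ deg′ v
  d≡deg′ v = ℕ.≤-antisym
    (length-⊆ (Unique.filter⁺ (v ~?_) (Unique.allFin⁺ n))
      (λ u∈ → ~⇒nbrs (proj₂ (∈-filter⁻ (v ~?_) {xs = allFin n} u∈))))
    (length-⊆ (unique v) (λ {u} u∈ → ∈-filter⁺ (v ~?_) (∈-allFin u) (nbrs⇒~ u∈)))

  minDeg : Fin n → Fin n → ℕ
  minDeg u v = deg′ u ⊓ deg′ v

  edgeSum nbrSum : ℕ
  edgeSum = sum (map (λ (u , v) → d u ⊓ d v) edges)
  nbrSum = sumBy (λ v → sumBy (λ u → minDeg u v) (nbrs v)) (allFin n)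

  -- Lets the constant overhead of an edge be charged to the edge itself.
  minDeg>0 : ∀ {u v} → u ∈ₗ nbrs v → 0 < minDeg u v
  minDeg>0 u∈ = ℕ.⊓-glb (∈-length (~⇒nbrs (~-sym (nbrs⇒~ u∈)))) (∈-length u∈)

  -- The adjacency lists contain each edge once in either direction, and the minimum degree is
  -- symmetric.
  nbrSum≤ : nbrSum ≤ 2 * edgeSum
  nbrSum≤ = begin
    nbrSum                                      ≡⟨ sumBy-pairsOf nbrs w (allFin n) ⟨
    sumBy w (pairsOf nbrs (allFin n))           ≤⟨ sumBy-⊆ w (pairsOf-unique nbrs (Unique.allFin⁺ n) unique) ⊆edges ⟩
    sumBy w (edges ++ map swap edges)           ≡⟨ sumBy-++ w edges (map swap edges) ⟩
    sumBy w edges + sumBy w (map swap edges)    ≡⟨ cong₂ _+_ forward backward ⟩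
    edgeSum + edgeSum                           ≡⟨ cong (edgeSum +_) (ℕ.+-identityʳ edgeSum) ⟨
    2 * edgeSum                                 ∎
    where
    open ℕ.≤-Reasoning
    w : Fin n × Fin n → ℕ
    w (v , u) = minDeg u v
    backward : sumBy w (map swap edges) ≡ edgeSum
    backward = trans (sumBy-map w swap edges)
      (cong sum (map-cong (λ (u , v) → sym (cong₂ _⊓_ (d≡deg′ u) (d≡deg′ v))) edges))
    forward : sumBy w edges ≡ edgeSum
    forward = cong sum (map-cong (λ (u , v) →
      trans (ℕ.⊓-comm (deg′ v) (deg′ u)) (sym (cong₂ _⊓_ (d≡deg′ u) (d≡deg′ v)))) edges)
    edge : ∀ {u v} → toℕ u < toℕ v → u ~ v → (u , v) ∈ₗ edges
    edge {u} {v} u<v u~v = ∈-filter⁺ (λ (u , v) → (u <? v) ×-dec (u ~? v))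
      (∈-cartesianProduct⁺ (∈-allFin u) (∈-allFin v)) (u<v , u~v)
    ⊆edges : ∀ {e} → e ∈ₗ pairsOf nbrs (allFin n) → e ∈ₗ edges ++ map swap edges
    ⊆edges {v , u} e∈ with _ , u∈ ← ∈-pairsOf⁻ nbrs (allFin n) e∈ with ℕ.<-cmp (toℕ v) (toℕ u)
    ... | tri< v<u _ _ = ∈-++⁺ˡ (edge v<u (nbrs⇒~ u∈))
    ... | tri> _ _ u<v = ∈-++⁺ʳ edges (∈-map⁺ swap (edge u<v (~-sym (nbrs⇒~ u∈))))
    ... | tri≈ _ v≡u _ with refl ← toℕ-injective v≡u = contradiction (nbrs⇒~ u∈) (~-irrefl v)

  -- Absorbs the cost per vertex: a vertex with a neighbour contributes at least 1 to `nbrSum`.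
  n≤nbrSum : (∀ v → 0 < d v) → n ≤ nbrSum
  n≤nbrSum pos = begin
    n                            ≡⟨ length-allFin n ⟨
    length (allFin n)            ≡⟨ ℕ.*-identityʳ _ ⟨
    length (allFin n) * 1        ≡⟨ sumBy-const 1 (allFin n) ⟨
    sumBy (λ _ → 1) (allFin n)   ≤⟨ sumBy-mono _ _ (allFin n) (λ {v} _ → some v) ⟩
    nbrSum                       ∎
    where
    open ℕ.≤-Reasoning
    some : ∀ v → 1 ≤ sumBy (λ u → minDeg u v) (nbrs v)
    some v = go (nbrs v) (subst (0 <_) (d≡deg′ v) (pos v)) (λ u∈ → u∈)
      where
      go : ∀ us → 0 < length us → (∀ {u} → u ∈ₗ us → u ∈ₗ nbrs v) → 1 ≤ sumBy (λ u → minDeg u v) us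
      go (u ∷ us) _ h = ℕ.≤-trans (minDeg>0 (h (here refl))) (ℕ.m≤m+n _ _)

  module _ (W c′ : ℕ)
    (small : 2 + wedgeCap n + (n + n + n) < W) (count<W : countCap n + (wedgeCap n + wedgeCap n) < W) where
    open Scanning A W c′ small count<W
    open Counting A W c′ small count<W

    private
      -- `25` steps for each visited neighbour of `u`, the loop test included, and `12` of overhead;
      -- together `37`.
      fanTime≤ : ∀ {v u} → u ∈ₗ nbrs v → suc (fanTime 15 v u) ≤ 37 * minDeg u v
      fanTime≤ {v} {u} u∈ = begin
        suc (fanTime 15 v u)    ≡⟨ lemma₁ k ⟩
        12 * 1 + 25 * k         ≤⟨ ℕ.+-monoˡ-≤ (25 * k) (ℕ.*-monoʳ-≤ 12 (minDeg>0 u∈)) ⟩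
        12 * k + 25 * k         ≡⟨ lemma₂ k ⟩
        37 * k                  ∎
        where
        open ℕ.≤-Reasoning
        k : ℕ
        k = minDeg u v
        lemma₁ : ∀ k → suc (1 + (1 + ((4 + (suc (k * 25) + 1)) + (1 + (1 + 1))))) ≡ 12 * 1 + 25 * k
        lemma₁ = solve-∀
        lemma₂ : ∀ k → 12 * k + 25 * k ≡ 37 * k
        lemma₂ = solve-∀

      -- Two walks at `37` per unit give `74`; the `8` is the overhead of the vertex.
      vertexTime≤ : ∀ v → suc (vertexTime v) ≤ 8 + 74 * sumBy (λ u → minDeg u v) (nbrs v)
      vertexTime≤ v = begin
        suc (1 + (suc F + 1 + (suc F + 1 + (1 + 1))))  ≡⟨ lemma₁ F ⟩
        8 + 2 * F                                      ≤⟨ ℕ.+-monoʳ-≤ 8 (ℕ.*-monoʳ-≤ 2 F≤) ⟩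
        8 + 2 * (37 * S)                               ≡⟨ lemma₂ S ⟩
        8 + 74 * S                                     ∎
        where
        open ℕ.≤-Reasoning
        F S : ℕ
        F = sumBy (λ u → suc (fanTime 15 v u)) (nbrs v)
        S = sumBy (λ u → minDeg u v) (nbrs v)
        F≤ : F ≤ 37 * S
        F≤ = ℕ.≤-trans (sumBy-mono _ (λ u → 37 * minDeg u v) (nbrs v) fanTime≤)
                       (ℕ.≤-reflexive (sumBy-* 37 (λ u → minDeg u v) (nbrs v)))
        lemma₁ : ∀ k → suc (1 + (suc k + 1 + (suc k + 1 + (1 + 1)))) ≡ 8 + 2 * k
        lemma₁ = solve-∀
        lemma₂ : ∀ k → 8 + 2 * (37 * k) ≡ 8 + 74 * k
        lemma₂ = solve-∀

    totalTime≤ : totalTime ≤ 3 + (8 * n + 74 * nbrSum)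
    totalTime≤ = ℕ.+-monoʳ-≤ 3 (begin
      sumBy (λ v → suc (vertexTime v)) (allFin n)   ≤⟨ sumBy-mono _ _ (allFin n) (λ {v} _ → vertexTime≤ v) ⟩
      sumBy (λ v → 8 + 74 * S v) (allFin n)         ≡⟨ sumBy-+ (λ _ → 8) (λ v → 74 * S v) (allFin n) ⟩
      sumBy (λ _ → 8) (allFin n) + sumBy (λ v → 74 * S v) (allFin n)
        ≡⟨ cong₂ _+_ (trans (sumBy-const 8 (allFin n)) (trans (cong (_* 8) (length-allFin n)) (ℕ.*-comm n 8)))
                     (sumBy-* 74 S (allFin n)) ⟩
      8 * n + 74 * nbrSum                           ∎)
      where
      open ℕ.≤-Reasoning
      S : Fin n → ℕ
      S v = sumBy (λ u → minDeg u v) (nbrs v)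

    totalTime≤-general : totalTime ≤ 170 * (1 + n + edgeSum)
    totalTime≤-general = begin
      totalTime                                 ≤⟨ totalTime≤ ⟩
      3 + (8 * n + 74 * nbrSum)                 ≤⟨ ℕ.+-monoʳ-≤ 3 (ℕ.+-monoʳ-≤ (8 * n) (ℕ.*-monoʳ-≤ 74 nbrSum≤)) ⟩
      3 + (8 * n + 74 * (2 * edgeSum))          ≤⟨ ℕ.m≤m+n _ (167 + (162 * n + 22 * edgeSum)) ⟩
      3 + (8 * n + 74 * (2 * edgeSum)) + (167 + (162 * n + 22 * edgeSum)) ≡⟨ lemma n edgeSum ⟩
      170 * (1 + n + edgeSum)                   ∎
      where
      open ℕ.≤-Reasoning
      lemma : ∀ n s → 3 + (8 * n + 74 * (2 * s)) + (167 + (162 * n + 22 * s)) ≡ 170 * (1 + n + s)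
      lemma = solve-∀

    -- The startup cost `3` is charged to `n`, and then `n` to `nbrSum`, which gives
    -- `3 + 8 + 74 = 85`. Doubling by `nbrSum≤` yields `170`, the constant used in the general bound
    -- too.
    totalTime≤-positive : NonZero n → (∀ v → 0 < d v) → totalTime ≤ 170 * edgeSum
    totalTime≤-positive n≢0 pos = begin
      totalTime                                 ≤⟨ totalTime≤ ⟩
      3 + (8 * n + 74 * nbrSum)                 ≤⟨ ℕ.+-mono-≤ (ℕ.*-monoʳ-≤ 3 (ℕ.>-nonZero⁻¹ n {{n≢0}})) ℕ.≤-refl ⟩
      3 * n + (8 * n + 74 * nbrSum)             ≤⟨ ℕ.+-mono-≤ (ℕ.*-monoʳ-≤ 3 n≤) (ℕ.+-monoˡ-≤ _ (ℕ.*-monoʳ-≤ 8 n≤)) ⟩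
      3 * nbrSum + (8 * nbrSum + 74 * nbrSum)   ≡⟨ lemma₁ nbrSum ⟩
      85 * nbrSum                               ≤⟨ ℕ.*-monoʳ-≤ 85 nbrSum≤ ⟩
      85 * (2 * edgeSum)                        ≡⟨ lemma₂ edgeSum ⟩
      170 * edgeSum                             ∎
      where
      open ℕ.≤-Reasoning
      n≤ : n ≤ nbrSum
      n≤ = n≤nbrSum pos
      lemma₁ : ∀ s → 3 * s + (8 * s + 74 * s) ≡ 85 * s
      lemma₁ = solve-∀
      lemma₂ : ∀ s → 85 * (2 * s) ≡ 170 * s
      lemma₂ = solve-∀

-- Passage to the rational average degeneracy, and the final constants.

toℚᵘ-toℚ : ∀ k → toℚᵘ (toℚ k) ℚᵘ.≃ mkℚᵘ (fromℕ k) 0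
toℚᵘ-toℚ k = ℚ.toℚᵘ-fromℚᵘ (mkℚᵘ (fromℕ k) 0)

toℚ-mono-≤ : ∀ {a b} → a ≤ b → toℚ a ℚ.≤ toℚ b
toℚ-mono-≤ {a} {b} a≤b = ℚ.toℚᵘ-cancel-≤
  (ℚᵘ.≤-respˡ-≃ (ℚᵘ.≃-sym (toℚᵘ-toℚ a)) (ℚᵘ.≤-respʳ-≃ (ℚᵘ.≃-sym (toℚᵘ-toℚ b))
    (*≤* (ℤ.*-monoʳ-≤-nonNeg (fromℕ 1) (ℤ.+≤+ a≤b)))))

toℚ-+ : ∀ a b → toℚ (a + b) ≡ toℚ a ℚ.+ toℚ b
toℚ-+ a b = ℚ.toℚᵘ-injective (begin
  toℚᵘ (toℚ (a + b))                ≈⟨ toℚᵘ-toℚ (a + b) ⟩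
  mkℚᵘ (fromℕ (a + b)) 0                ≈⟨ *≡* (cong (ℤ._* fromℕ 1) (sym (cong₂ ℤ._+_ (ℤ.*-identityʳ (fromℕ a)) (ℤ.*-identityʳ (fromℕ b))))) ⟩
  mkℚᵘ (fromℕ a) 0 ℚᵘ.+ mkℚᵘ (fromℕ b) 0    ≈⟨ ℚᵘ.+-cong (toℚᵘ-toℚ a) (toℚᵘ-toℚ b) ⟨
  toℚᵘ (toℚ a) ℚᵘ.+ toℚᵘ (toℚ b)    ≈⟨ ℚ.toℚᵘ-homo-+ (toℚ a) (toℚ b) ⟨
  toℚᵘ (toℚ a ℚ.+ toℚ b)            ∎)
  where open import Relation.Binary.Reasoning.Setoid ℚᵘ.≃-setoid

toℚ-* : ∀ a b → toℚ (a * b) ≡ toℚ a ℚ.* toℚ b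
toℚ-* a b = ℚ.toℚᵘ-injective (begin
  toℚᵘ (toℚ (a * b))                ≈⟨ toℚᵘ-toℚ (a * b) ⟩
  mkℚᵘ (fromℕ (a * b)) 0                ≈⟨ *≡* (cong (ℤ._* fromℕ 1) (ℤ.pos-* a b)) ⟩
  mkℚᵘ (fromℕ a) 0 ℚᵘ.* mkℚᵘ (fromℕ b) 0    ≈⟨ ℚᵘ.*-cong (toℚᵘ-toℚ a) (toℚᵘ-toℚ b) ⟨
  toℚᵘ (toℚ a) ℚᵘ.* toℚᵘ (toℚ b)    ≈⟨ ℚ.toℚᵘ-homo-* (toℚ a) (toℚ b) ⟨
  toℚᵘ (toℚ a ℚ.* toℚ b)            ∎)
  where open import Relation.Binary.Reasoning.Setoid ℚᵘ.≃-setoid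

-- Turns `m` times the average degeneracy into the natural number `edgeSum`. The convention for the
-- empty mean makes it hold without edges as well.
length*mean : ∀ xs → toℚ (length xs) ℚ.* mean xs ≡ toℚ (sum xs)
length*mean []          = refl
length*mean xs@(_ ∷ ys) = ℚ.toℚᵘ-injective (begin
  toℚᵘ (toℚ l ℚ.* mean xs)                   ≈⟨ ℚ.toℚᵘ-homo-* (toℚ l) (mean xs) ⟩
  toℚᵘ (toℚ l) ℚᵘ.* toℚᵘ (mean xs)           ≈⟨ ℚᵘ.*-cong (toℚᵘ-toℚ l) (ℚ.toℚᵘ-fromℚᵘ (mkℚᵘ (fromℕ (sum xs)) (length ys))) ⟩
  mkℚᵘ (fromℕ l) 0 ℚᵘ.* mkℚᵘ (fromℕ (sum xs)) (length ys)  ≈⟨ *≡* cancel ⟩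
  mkℚᵘ (fromℕ (sum xs)) 0                          ≈⟨ toℚᵘ-toℚ (sum xs) ⟨
  toℚᵘ (toℚ (sum xs))                        ∎)
  where
  open import Relation.Binary.Reasoning.Setoid ℚᵘ.≃-setoid
  l : ℕ
  l = length xs
  cancel : (fromℕ l ℤ.* fromℕ (sum xs)) ℤ.* fromℕ 1 ≡ fromℕ (sum xs) ℤ.* fromℕ (1 * l)
  cancel = trans (ℤ.*-identityʳ _) (trans (ℤ.*-comm (fromℕ l) (fromℕ (sum xs)))
    (cong (λ k → fromℕ (sum xs) ℤ.* fromℕ k) (sym (ℕ.*-identityˡ l))))

-- 8 N⁵ with N = 2 + n dominates every word of the computation.
caps : ∀ n {c} → 8 < c →
       2 + wedgeCap n + (n + n + n) < (2 + n) ^ c × countCap n + (wedgeCap n + wedgeCap n) < (2 + n) ^ c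
caps n {c} 8<c =
  -- The added polynomial is the difference between `8 * N ^ 5` and the cap; all its coefficients
  -- are nonnegative. The same holds for the second component.
  ℕ.≤-<-trans (ℕ.≤-trans (ℕ.m≤m+n _ (8 * n * n * n * n * n + 80 * n * n * n * n + 320 * n * n * n + 639 * n * n + 636 * n + 254))
                         (ℕ.≤-reflexive (lemma₁ n))) 8N⁵< ,
  ℕ.≤-<-trans (ℕ.≤-trans (ℕ.m≤m+n _ (5 * n * n * n * n * n + 71 * n * n * n * n + 311 * n * n * n + 635 * n * n + 638 * n + 256))
                         (ℕ.≤-reflexive (lemma₂ n))) 8N⁵<
  where
  N : ℕ
  N = 2 + n
  8N⁵< : 8 * N ^ 5 < N ^ c
  8N⁵< = begin-strict
    8 * N ^ 5      ≤⟨ ℕ.*-monoˡ-≤ (N ^ 5) (ℕ.^-monoˡ-≤ 3 {2} {N} (s≤s (s≤s z≤n))) ⟩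
    N ^ 3 * N ^ 5  ≡⟨ ℕ.^-distribˡ-+-* N 3 5 ⟨
    N ^ 8          <⟨ ℕ.^-monoʳ-< N (s≤s (s≤s z≤n)) 8<c ⟩
    N ^ c          ∎
    where open ℕ.≤-Reasoning
  lemma₁ : ∀ n → 2 + (n + n * n) + (n + n + n) +
    (8 * n * n * n * n * n + 80 * n * n * n * n + 320 * n * n * n + 639 * n * n + 636 * n + 254) ≡
    8 * ((2 + n) * ((2 + n) * ((2 + n) * ((2 + n) * ((2 + n) * 1)))))
  lemma₁ = solve-∀
  lemma₂ : ∀ n → n * (3 * ((n + n * n) * (n + n * n))) + 3 * ((n + n * n) * (n + n * n)) + ((n + n * n) + (n + n * n)) +
    (5 * n * n * n * n * n + 71 * n * n * n * n + 311 * n * n * n + 635 * n * n + 638 * n + 256) ≡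
    8 * ((2 + n) * ((2 + n) * ((2 + n) * ((2 + n) * ((2 + n) * 1)))))
  lemma₂ = solve-∀

-- Kept apart from the final theorem so that the word bound W stays a variable:
-- conversion checking would otherwise unfold the power (2 + n) ^ c.
count-C₄-correct : ∀ c′ W → 170 ≤ 3 + c′ → ∀ {n} {G : Graph n} (A : AdjacencyLists G) →
  2 + wedgeCap n + (n + n + n) < W × countCap n + (wedgeCap n + wedgeCap n) < W →
  let c = 3 + c′ ; mδ̄ = toℚ (Graph.m G) ℚ.* avgDegeneracy G in
  ∃[ t ] Σ[ τ ∈ State 14 (c * n) ]
  ( Run A W count-C₄ initial t τ
  × (∀ v → Holds (mem τ) (toℕ v) (□ G v))
  × toℚ t ℚ.≤ toℚ c ℚ.* (toℚ (1 + n) ℚ.+ mδ̄)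
  × (NonZero n → (∀ v → 0 < Graph.d G v) → toℚ t ℚ.≤ toℚ c ℚ.* mδ̄))
count-C₄-correct c′ W 170≤c {n} {G} A (small , count<W) =
  time , final , run ,
  (λ v → cell 0F v , addr₀ v , post v) ,
  subst (λ q → toℚ time ℚ.≤ toℚ (3 + c′) ℚ.* q) (trans (toℚ-+ (1 + n) edgeSum) (cong (toℚ (1 + n) ℚ.+_) edgeSum≡))
    (bounded (1 + n + edgeSum) (totalTime≤-general W c′ small count<W)) ,
  λ n≢0 deg>0 → subst (λ q → toℚ time ℚ.≤ toℚ (3 + c′) ℚ.* q) edgeSum≡
    (bounded edgeSum (totalTime≤-positive W c′ small count<W n≢0 deg>0))
  where
  open Cost A
  open Banks n c′
  open Execution.Exec (Counting.count-C₄-exec A W c′ small count<W)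
  edgeSum≡ : toℚ edgeSum ≡ toℚ (Graph.m G) ℚ.* avgDegeneracy G
  edgeSum≡ = sym (trans (cong (λ l → toℚ l ℚ.* avgDegeneracy G) (sym (length-map _ (Graph.edges G))))
                        (length*mean (map _ (Graph.edges G))))
  bounded : ∀ s → Counting.totalTime A W c′ small count<W ≤ 170 * s → toℚ time ℚ.≤ toℚ (3 + c′) ℚ.* toℚ s
  bounded s T≤ = subst (toℚ time ℚ.≤_) (toℚ-* (3 + c′) s)
    (toℚ-mono-≤ (ℕ.≤-trans time≤ (ℕ.≤-trans T≤ (ℕ.*-monoˡ-≤ s 170≤c))))

theorem2 : ∃[ k ] Σ[ P ∈ Program k ] ∃[ c ]
    (∀ n (G : Graph n) (A : AdjacencyLists G) →
    let mδ̄ = toℚ (Graph.m G) ℚ.* avgDegeneracy G in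
    ∃[ t ] Σ[ τ ∈ State k (c * n) ]
    ( Run A ((2 + n) ^ c) P initial t τ
    × (∀ v → Holds (mem τ) (toℕ v) (□ G v))
    × toℚ t ℚ.≤ toℚ c ℚ.* (toℚ (1 + n) ℚ.+ mδ̄)
    × (NonZero n → (∀ v → 0 < Graph.d G v) → toℚ t ℚ.≤ toℚ c ℚ.* mδ̄)))
-- One constant plays three roles: the time factor needs `170`, the number of banks at least `3`
-- (hence `167` further ones), and the exponent of the word bound more than `8`.
theorem2 = 14 , count-C₄ , 170 , λ n G A → count-C₄-correct 167 ((2 + n) ^ 170) ℕ.≤-refl A (caps n (ℕ.≤ᵇ⇒≤ 9 170 _))
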